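{- For all integers $k \ge 3$ and $\ell \ge 2$ there exists a connected plane graph $G$ with exactly $f := 2k(\ell-1)+2$ faces such that $$\mathfrak{c}(G;f) = \frac{\ell(\ell+1)}{2} \quad\text{and}\quad \dot{\mathfrak{c}}(G;f) = 1.$$ Furthermore, such a graph $G$ can be chosen to be $3$-connected when $k=3$ and $\ell \ge 3$, and $4$-connected otherwise.
   Context: A cycle is a connected $2$-regular graph. A cycle double cover (CDC) of a graph $G$ is a multiset of cycles of $G$ such that every edge of $G$ lies in exactly two members, counted with multiplicity; its size is the number of cycles counted with multiplicity. A CDC is true if no cycle appears in it twice. $\mathfrak{c}(G;k)$ denotes the number of distinct CDCs of $G$ of size exactly $k$, and $\dot{\mathfrak{c}}(G;k)$ the number of distinct true CDCs of $G$ of size exactly $k$. -}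

module Defs where

open import Data.Nat using (ℕ; zero; suc; _+_; _<_)
open import Data.Bool using (Bool; true; false; not)
open import Data.Fin using (Fin; zero; suc; _≟_)
open import Data.Fin.Subset using (Subset; _∈_; _∉_; ∣_∣)
open import Data.Fin.Subset.Properties using (_∈?_)
open import Data.Product using (Σ; ∃; _×_; _,_; proj₁; proj₂)
open import Data.Sum using (_⊎_)
open import Data.Unit using (⊤)
open import Data.List using (List; length; filter)
open import Data.List.Relation.Unary.All using (All)
open import Data.List.Relation.Unary.Unique.Propositional using (Unique)
open import Data.List.Relation.Binary.Permutation.Propositional using (_↭_)
open import Relation.Nullary using (Dec; yes; no)
open import Relation.Binary.PropositionalEquality using (_≡_)
open import Function.Bundles using (_⇔_)

∑ : ∀ {m} → (Fin m → ℕ) → ℕ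
∑ {zero}  f = 0
∑ {suc m} f = f zero + ∑ (λ i → f (suc i))

⟦_⟧ : ∀ {P : Set} → Dec P → ℕ
⟦ yes _ ⟧ = 1
⟦ no  _ ⟧ = 0

iterate : ∀ {A : Set} → (A → A) → ℕ → A → A
iterate f zero    x = x
iterate f (suc i) x = f (iterate f i x)

SameOrbit : ∀ {A : Set} → (A → A) → A → A → Set
SameOrbit f x y = ∃ λ i → iterate f i x ≡ y

NumClasses : (A : Set) → (A → A → Set) → ℕ → Set
NumClasses A _~_ N =
  Σ (A → Fin N) λ cls →
    (∀ j → ∃ λ x → cls x ≡ j) × (∀ x y → (cls x ≡ cls y) ⇔ (x ~ y))

record Graph : Set where
  field
    n    : ℕ
    m    : ℕ
    ends : Fin m → Fin n × Fin n
open Graph public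

module _ (G : Graph) where

  Adj : Fin (m G) → Fin (n G) → Fin (n G) → Set
  Adj e u w = (ends G e ≡ (u , w)) ⊎ (ends G e ≡ (w , u))

  -- walks using only edges satisfying okE and only vertices satisfying okV
  -- (after the starting vertex)
  data Reach (okE : Fin (m G) → Set) (okV : Fin (n G) → Set)
       : Fin (n G) → Fin (n G) → Set where
    here : ∀ {u} → Reach okE okV u u
    step : ∀ {u w v} (e : Fin (m G)) → okE e → okV w → Adj e u w →
           Reach okE okV w v → Reach okE okV u v

  Connected : Set
  Connected = ∀ u v → Reach (λ _ → ⊤) (λ _ → ⊤) u v

  KConnected : ℕ → Set
  KConnected k = (k < n G) ×
    (∀ (X : Subset (n G)) → ∣ X ∣ < k → ∀ u v → u ∉ X → v ∉ X →
       Reach (λ _ → ⊤) (λ w → w ∉ X) u v)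

  -- Cycles, as edge sets of connected 2-regular subgraphs

  deg : Subset (m G) → Fin (n G) → ℕ
  deg C v = ∑ (λ e → inC e (e ∈? C))
    where
    inC : ∀ e → Dec (e ∈ C) → ℕ
    inC e (yes _) = ⟦ proj₁ (ends G e) ≟ v ⟧ + ⟦ proj₂ (ends G e) ≟ v ⟧
    inC e (no _)  = 0

  IsCycle : Subset (m G) → Set
  IsCycle C =
    (∃ λ e → e ∈ C) ×
    (∀ v → (deg C v ≡ 0) ⊎ (deg C v ≡ 2)) ×
    (∀ e e′ → e ∈ C → e′ ∈ C →
       Reach (λ x → x ∈ C) (λ _ → ⊤) (proj₁ (ends G e)) (proj₁ (ends G e′)))

  cover : Fin (m G) → List (Subset (m G)) → ℕ
  cover e L = length (filter (λ C → e ∈? C) L)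

  -- a CDC of size k, as a list (a multiset up to permutation) of cycles
  IsCDC : ℕ → List (Subset (m G)) → Set
  IsCDC k L = All IsCycle L × (∀ e → cover e L ≡ 2) × (length L ≡ k)

  CDC : ℕ → Set
  CDC k = Σ (List (Subset (m G))) (IsCDC k)

  TrueCDC : ℕ → Set
  TrueCDC k = Σ (List (Subset (m G))) (λ L → IsCDC k L × Unique L)

  NumCDC : ℕ → ℕ → Set
  NumCDC k N = NumClasses (CDC k) (λ x y → proj₁ x ↭ proj₁ y) N

  NumTrueCDC : ℕ → ℕ → Set
  NumTrueCDC k N = NumClasses (TrueCDC k) (λ x y → proj₁ x ↭ proj₁ y) N

  -- Plane embeddings as rotation systems (combinatorial maps)

  Dart : Set
  Dart = Fin (m G) × Bool

  vert : Dart → Fin (n G)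
  vert (e , false) = proj₁ (ends G e)
  vert (e , true)  = proj₂ (ends G e)

  α : Dart → Dart
  α (e , b) = (e , not b)

  record Rotation : Set where
    field
      σ      : Dart → Dart
      σ-vert : ∀ x → vert (σ x) ≡ vert x
      σ-cyc  : ∀ x y → vert x ≡ vert y → SameOrbit σ x y

  -- the embedding has exactly F faces (face boundaries = orbits of σ ∘ α)
  HasFaces : Rotation → ℕ → Set
  HasFaces ρ F = NumClasses Dart (SameOrbit (λ x → Rotation.σ ρ (α x))) F

  -- connected plane graph with exactly F faces: a connected graph with a
  -- rotation system of genus 0 (Euler: n - m + F = 2) having F faces
  ConnectedPlaneWithFaces : ℕ → Set
  ConnectedPlaneWithFaces F =
    Connected × Σ Rotation (λ ρ → HasFaces ρ F × (n G + F ≡ m G + 2))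

{-# OPTIONS --safe #-}
module Submission where

-- G is the stack of ℓ - 1 antiprisms over a k-gon: ℓ concentric rings of length k, consecutive rings
-- being joined by a band of 2k triangles.  Give each ring edge weight 2 and each other (zigzag) edge
-- weight k - 1.  A cycle uses an even number of zigzag edges (colour the rings alternately), so it
-- has weight at least 2k, with equality exactly for the rings and the triangles.  The total edge
-- weight is k f, so every member of a double cover of size f is a ring or a triangle.  In each band
-- covering the zigzag edges twice forces all upward triangles to have the same multiplicity a, and
-- all downward ones 2 - a; covering the ring edges twice forces these values to descend from ring to
-- ring, starting from 2 and ending with 0, each ring having the size of the drop as multiplicity.
-- There are ℓ (ℓ + 1) / 2 descending sequences, and only the constant sequence 1 gives a true cover.
--
-- For connectivity, remove at most three vertices, and at most two if k = 3 and ℓ ≥ 3.  A ring that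
-- lost at most one vertex stays connected, and every vertex of a ring that lost two or more still
-- has a neighbour in an adjacent ring, which then lost at most one.  Unless G is the octahedron, some
-- column lost no vertex and links the rings.

open import Defs
open import Data.Bool using (Bool; true; false; not)
import Data.Bool.Properties as Bool
open import Data.Fin using (Fin; zero; suc; _≟_; inject₁; fromℕ; toℕ; splitAt; join; remQuot; _↑ˡ_; _↑ʳ_)
open import Data.Fin.Induction using (<-weakInduction; >-weakInduction)
open import Data.Fin.Properties using (any?; all?; ¬∀⟶∃¬; pigeonhole; suc-injective; toℕ-inject₁; toℕ-injective; fromℕ≢inject₁; inject₁-injective; splitAt-↑ˡ; splitAt-↑ʳ; ↑ˡ-injective; ↑ʳ-injective; join-splitAt; +↔⊎; *↔×)
open import Data.Fin.Relation.Unary.Top using (view; ‵fromℕ; ‵inject₁; view-fromℕ; view-inject₁)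
open import Data.Fin.Subset using (Subset; _∈_; _∉_; ∣_∣; ⊥)
open import Data.Fin.Subset.Properties using (_∈?_; ⊆-antisym; ∉⊥; ∣⊥∣≡0)
open import Data.List using (List; []; _∷_; _++_; length; replicate)
open import Data.List.Membership.Propositional.Properties using (∈-∃++)
import Data.List.Membership.Propositional as List
open import Data.List.Properties using (length-++; length-replicate)
open import Data.List.Relation.Binary.Permutation.Propositional as Perm using (_↭_; ↭-refl; ↭-sym; ↭-trans; prep; swap)
open import Data.List.Relation.Binary.Permutation.Propositional.Properties using (shift)
open import Data.List.Relation.Unary.All as All using (All; []; _∷_)
import Data.List.Relation.Unary.All.Properties as All
open import Data.List.Relation.Unary.AllPairs using ([]; _∷_)
open import Data.List.Relation.Unary.Any using (here; there)
open import Data.List.Relation.Unary.Unique.Propositional using (Unique)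
open import Data.Nat as ℕ using (ℕ; zero; suc; _+_; _*_; _∸_; _≤_; _<_; z≤n; s≤s; _/_)
open import Data.Nat.DivMod using (m*n/n≡m)
open import Data.Nat.Properties hiding (_≟_; suc-injective)
open import Algebra.Properties.CommutativeSemigroup +-commutativeSemigroup using (interchange)
open import Data.Nat.Tactic.RingSolver using (solve-∀)
open import Data.Product using (Σ; ∃; ∃₂; _×_; _,_; proj₁; proj₂)
open import Data.Sum using (_⊎_; inj₁; inj₂; map; map₁)
open import Data.Sum.Function.Propositional using (_⊎-↔_)
open import Data.Unit using (⊤; tt)
open import Data.Vec using (tabulate; []; _∷_; there)
open import Data.Vec.Functional using () renaming (_∷_ to extend)
open import Data.Vec.Properties using (lookup∘tabulate; []=⇒lookup; lookup⇒[]=; ≡-dec)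
open import Function using (_∘_; id; _↔_; Inverse; mk⇔; Injective)
open import Function.Properties.Inverse using (↔-refl; ↔-sym; ↔-trans)
open import Relation.Binary.Definitions using (DecidableEquality; Tri; tri<; tri≈; tri>)
open import Relation.Binary.PropositionalEquality
open import Relation.Nullary using (Dec; yes; no; ¬_; contradiction; does)
open import Relation.Nullary.Decidable using (_×-dec_; ¬?; dec-true; decidable-stable)

-- Indicators of decidable propositions.

⟦yes⟧ : ∀ {P : Set} (d : Dec P) → P → ⟦ d ⟧ ≡ 1
⟦yes⟧ (yes _) _ = refl
⟦yes⟧ (no ¬p) p = contradiction p ¬p

⟦no⟧ : ∀ {P : Set} (d : Dec P) → ¬ P → ⟦ d ⟧ ≡ 0
⟦no⟧ (yes p) ¬p = contradiction p ¬p
⟦no⟧ (no _)  _  = refl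

⟦⟧-cong : ∀ {P Q : Set} (d : Dec P) (d′ : Dec Q) → (P → Q) → (Q → P) → ⟦ d ⟧ ≡ ⟦ d′ ⟧
⟦⟧-cong (yes p) d′ f g = sym (⟦yes⟧ d′ (f p))
⟦⟧-cong (no ¬p) d′ f g = sym (⟦no⟧ d′ (¬p ∘ g))

-- Finite sums

∑-cong : ∀ {m} {f g : Fin m → ℕ} → (∀ i → f i ≡ g i) → ∑ f ≡ ∑ g
∑-cong {zero}  eq = refl
∑-cong {suc m} eq = cong₂ _+_ (eq zero) (∑-cong (λ i → eq (suc i)))

∑-mono : ∀ {m} {f g : Fin m → ℕ} → (∀ i → f i ≤ g i) → ∑ f ≤ ∑ g
∑-mono {zero}  le = z≤n
∑-mono {suc m} le = +-mono-≤ (le zero) (∑-mono (λ i → le (suc i)))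

∑-const : ∀ {m} c → ∑ {m} (λ _ → c) ≡ m * c
∑-const {zero}  c = refl
∑-const {suc m} c = cong (c +_) (∑-const {m} c)

∑-zero : ∀ {m} → ∑ {m} (λ _ → 0) ≡ 0
∑-zero {m} = trans (∑-const {m} 0) (*-zeroʳ m)

∑-+ : ∀ {m} (f g : Fin m → ℕ) → ∑ (λ i → f i + g i) ≡ ∑ f + ∑ g
∑-+ {zero}  f g = refl
∑-+ {suc m} f g =
  trans (cong (f zero + g zero +_) (∑-+ (f ∘ suc) (g ∘ suc)))
        (interchange (f zero) (g zero) _ _)

∑-*ˡ : ∀ {m} c (f : Fin m → ℕ) → ∑ (λ i → c * f i) ≡ c * ∑ f
∑-*ˡ {zero}  c f = sym (*-zeroʳ c)
∑-*ˡ {suc m} c f =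
  trans (cong (c * f zero +_) (∑-*ˡ c (f ∘ suc))) (sym (*-distribˡ-+ c (f zero) _))

∑-*ʳ : ∀ {m} c (f : Fin m → ℕ) → ∑ (λ i → f i * c) ≡ ∑ f * c
∑-*ʳ c f = trans (∑-cong (λ i → *-comm (f i) c)) (trans (∑-*ˡ c f) (*-comm c _))

∑-swap : ∀ {m n} (f : Fin m → Fin n → ℕ) → ∑ (λ i → ∑ (f i)) ≡ ∑ (λ j → ∑ (λ i → f i j))
∑-swap {zero} {n} f = sym (∑-zero {n})
∑-swap {suc m} f =
  trans (cong (∑ (f zero) +_) (∑-swap (f ∘ suc)))
        (sym (∑-+ (f zero) (λ j → ∑ (λ i → f (suc i) j))))

∑-supported-at : ∀ {m} (f : Fin m → ℕ) i → (∀ j → j ≢ i → f j ≡ 0) → ∑ f ≡ f i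
∑-supported-at {suc m} f zero z =
  trans (cong (f zero +_) (trans (∑-cong (λ j → z (suc j) (λ ()))) (∑-zero {m}))) (+-identityʳ _)
∑-supported-at f (suc i) z =
  cong₂ _+_ (z zero (λ ())) (∑-supported-at (f ∘ suc) i (λ j ne → z (suc j) (ne ∘ suc-injective)))

∑-indicator : ∀ {m} (i : Fin m) (f : Fin m → ℕ) → ∑ (λ j → ⟦ i ≟ j ⟧ * f j) ≡ f i
∑-indicator i f =
  trans (∑-supported-at _ i (λ j ne → cong (_* f j) (⟦no⟧ (i ≟ j) (ne ∘ sym))))
        (trans (cong (_* f i) (⟦yes⟧ (i ≟ i) refl)) (*-identityˡ (f i)))

∑-splitAt : ∀ m {n} (f : Fin m ⊎ Fin n → ℕ) →
  ∑ {m + n} (λ i → f (splitAt m i)) ≡ ∑ (f ∘ inj₁) + ∑ (f ∘ inj₂)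
∑-splitAt zero    f = refl
∑-splitAt (suc m) f =
  trans (cong (f (inj₁ zero) +_) (∑-splitAt m (f ∘ map suc id)))
        (sym (+-assoc (f (inj₁ zero)) _ _))

Inj : {A B : Set} → (A → B) → Set
Inj = Injective _≡_ _≡_

extend-injective : ∀ {A : Set} {p} {a : A} {g : Fin p → A} → (∀ i → g i ≢ a) → Inj g → Inj (extend a g)
extend-injective ne gi {zero}  {zero}  eq = refl
extend-injective ne gi {zero}  {suc j} eq = contradiction (sym eq) (ne j)
extend-injective ne gi {suc i} {zero}  eq = contradiction eq (ne i)
extend-injective ne gi {suc i} {suc j} eq = cong suc (gi eq)

pair : {A : Set} → A → A → Fin 2 → A
pair a b = extend a (λ _ → b)

pair-injective : ∀ {A : Set} {a b : A} → a ≢ b → Inj (pair a b)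
pair-injective a≢b = extend-injective (λ _ → a≢b ∘ sym) (λ { {zero} {zero} _ → refl })

three : {A : Set} → A → A → A → Fin 3 → A
three a b c = extend a (pair b c)

three-injective : ∀ {A : Set} {a b c : A} → a ≢ b → a ≢ c → b ≢ c → Inj (three a b c)
three-injective a≢b a≢c b≢c =
  extend-injective (λ { zero → a≢b ∘ sym ; (suc zero) → a≢c ∘ sym }) (pair-injective b≢c)

module _ {p m} (g : Fin p → Fin m) (g-inj : Inj g) where

  -- As `g` is injective, this is the indicator function of its image, written as a sum so that it
  -- can be exchanged with other sums.
  fibre-size : Fin m → ℕ
  fibre-size e = ∑ (λ i → ⟦ g i ≟ e ⟧)

  fibre-size-image : ∀ i → fibre-size (g i) ≡ 1
  fibre-size-image i =
    trans (∑-supported-at _ i (λ j ne → ⟦no⟧ (g j ≟ g i) (ne ∘ g-inj))) (⟦yes⟧ (g i ≟ g i) refl)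

  fibre-size-empty : ∀ e → ¬ (∃ λ i → g i ≡ e) → fibre-size e ≡ 0
  fibre-size-empty e ¬i = trans (∑-cong (λ i → ⟦no⟧ (g i ≟ e) (λ eq → ¬i (i , eq)))) (∑-zero {p})

  fibre-size≤ : ∀ e c → (∀ i → g i ≡ e → 1 ≤ c) → fibre-size e ≤ c
  fibre-size≤ e c h with any? (λ i → g i ≟ e)
  ... | yes (i , refl) = subst (_≤ c) (sym (fibre-size-image i)) (h i refl)
  ... | no ¬i = subst (_≤ c) (sym (fibre-size-empty e ¬i)) z≤n

  ∑-image : ∀ (f : Fin m → ℕ) → ∑ (f ∘ g) ≡ ∑ (λ e → fibre-size e * f e)
  ∑-image f =
    trans (∑-cong (λ i → sym (∑-indicator (g i) f)))
    (trans (∑-swap (λ i e → ⟦ g i ≟ e ⟧ * f e))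
           (∑-cong (λ e → ∑-*ʳ (f e) (λ i → ⟦ g i ≟ e ⟧))))

-- Sums over subsets

χ : ∀ {m} → Subset m → Fin m → ℕ
χ C e = ⟦ e ∈? C ⟧

sumOver : ∀ {m} → Subset m → (Fin m → ℕ) → ℕ
sumOver C f = ∑ (λ e → χ C e * f e)

sumOver-injection : ∀ {p m} (C : Subset m) (f : Fin m → ℕ) (g : Fin p → Fin m) → Inj g →
  (∀ i → g i ∈ C) → ∑ (f ∘ g) ≤ sumOver C f
sumOver-injection C f g g-inj g∈C = subst (_≤ sumOver C f) (sym (∑-image g g-inj f))
  (∑-mono (λ e → *-monoˡ-≤ (f e) (fibre-size≤ g g-inj e (χ C e)
    (λ { i refl → ≤-reflexive (sym (⟦yes⟧ (g i ∈? C) (g∈C i))) }))))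

sumOver-bijection : ∀ {p m} (C : Subset m) (f : Fin m → ℕ) (g : Fin p → Fin m) → Inj g →
  (∀ i → g i ∈ C) → (∀ e → e ∈ C → ∃ λ i → g i ≡ e) → sumOver C f ≡ ∑ (f ∘ g)
sumOver-bijection C f g g-inj g∈C onto =
  trans (∑-cong (λ e → cong (_* f e) (eq e))) (sym (∑-image g g-inj f))
  where
  eq : ∀ e → χ C e ≡ fibre-size g g-inj e
  eq e with e ∈? C
  ... | yes e∈ with onto e e∈
  ...   | i , refl = sym (fibre-size-image g g-inj i)
  eq e | no e∉ = sym (fibre-size-empty g g-inj e (λ { (i , refl) → e∉ (g∈C i) }))

∣∣≡∑χ : ∀ {m} (X : Subset m) → ∣ X ∣ ≡ sumOver X (λ _ → 1)
∣∣≡∑χ {zero} [] = refl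
∣∣≡∑χ {suc m} (x ∷ X) = prepend x (trans (∣∣≡∑χ X) (∑-cong {m} (λ e → cong (_* 1)
  (⟦⟧-cong (e ∈? X) (suc e ∈? (x ∷ X)) there (λ { (there p) → p })))))
  where
  prepend : ∀ x {a} → ∣ X ∣ ≡ a → ∣ x ∷ X ∣ ≡ χ (x ∷ X) zero * 1 + a
  prepend true  = cong suc
  prepend false = id

injection⇒≤∣∣ : ∀ {p m} (X : Subset m) (g : Fin p → Fin m) → Inj g → (∀ i → g i ∈ X) → p ≤ ∣ X ∣
injection⇒≤∣∣ {p} X g g-inj g∈X = subst₂ _≤_ (trans (∑-const {p} 1) (*-identityʳ p)) (sym (∣∣≡∑χ X))
  (sumOver-injection X (λ _ → 1) g g-inj g∈X)

image : ∀ {p m} → (Fin p → Fin m) → Subset m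
image g = tabulate (λ e → does (any? (λ i → g i ≟ e)))

∈-image⁺ : ∀ {p m} (g : Fin p → Fin m) i → g i ∈ image g
∈-image⁺ g i = lookup⇒[]= _ _ (trans (lookup∘tabulate _ (g i)) (dec-true (any? (λ j → g j ≟ g i)) (i , refl)))

∈-image⁻ : ∀ {p m} (g : Fin p → Fin m) e → e ∈ image g → ∃ λ i → g i ≡ e
∈-image⁻ g e e∈
  with any? (λ i → g i ≟ e)
     | trans (sym (lookup∘tabulate (λ e → does (any? (λ i → g i ≟ e))) e)) ([]=⇒lookup e∈)
... | yes p | _ = p
... | no _  | ()

sumOver-positive : ∀ {m} (C : Subset m) f → 0 < sumOver C f → ∃ λ e → e ∈ C × f e ≢ 0
sumOver-positive {m} C f lt with any? (λ e → (e ∈? C) ×-dec ¬? (f e ℕ.≟ 0))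
... | yes r = r
... | no none = contradiction (trans (∑-cong z) (∑-zero {m})) (<⇒≢ lt ∘ sym)
  where
  z : ∀ e → χ C e * f e ≡ 0
  z e with e ∈? C | f e ℕ.≟ 0
  ... | no _   | _     = refl
  ... | yes _  | yes q = trans (+-identityʳ _) q
  ... | yes e∈ | no q  = contradiction (e , e∈ , q) none

sumOver-+ : ∀ {m} (C : Subset m) f g → sumOver C (λ e → f e + g e) ≡ sumOver C f + sumOver C g
sumOver-+ {m} C f g = trans (∑-cong (λ e → *-distribˡ-+ (χ C e) (f e) (g e))) (∑-+ {m} _ _)

sumOver-*ˡ : ∀ {m} (C : Subset m) c f → sumOver C (λ e → c * f e) ≡ c * sumOver C f
sumOver-*ˡ {m} C c f = trans (∑-cong (λ e → comm (χ C e) c (f e))) (∑-*ˡ {m} c _)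
  where
  comm : ∀ x y z → x * (y * z) ≡ y * (x * z)
  comm = solve-∀

sumOver-cong : ∀ {m} (C : Subset m) {f g} → (∀ e → f e ≡ g e) → sumOver C f ≡ sumOver C g
sumOver-cong C h = ∑-cong (λ e → cong (χ C e *_) (h e))

-- The cyclic successor

next prev : ∀ {n} → Fin (suc n) → Fin (suc n)
next j with view j
... | ‵fromℕ     = zero
... | ‵inject₁ i = suc i
prev {n} zero = fromℕ n
prev (suc i)  = inject₁ i

next-fromℕ : ∀ n → next (fromℕ n) ≡ zero
next-fromℕ n rewrite view-fromℕ n = refl

next-inject₁ : ∀ {n} (i : Fin n) → next (inject₁ i) ≡ suc i
next-inject₁ i rewrite view-inject₁ i = refl

next-prev : ∀ {n} (j : Fin (suc n)) → next (prev j) ≡ j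
next-prev {n} zero = next-fromℕ n
next-prev (suc j)  = next-inject₁ j

prev-next : ∀ {n} (j : Fin (suc n)) → prev (next j) ≡ j
prev-next j with view j
... | ‵fromℕ     = refl
... | ‵inject₁ i = refl

next-injective : ∀ {n} → Inj (next {n})
next-injective {x = x} {y} eq = trans (sym (prev-next x)) (trans (cong prev eq) (prev-next y))

suc≢inject₁ : ∀ {n} (i : Fin n) → suc i ≢ inject₁ i
suc≢inject₁ (suc i) eq = suc≢inject₁ i (suc-injective eq)

prev-irrefl : ∀ {n} (j : Fin (suc (suc n))) → prev j ≢ j
prev-irrefl zero    ()
prev-irrefl (suc j) eq = suc≢inject₁ j (sym eq)

next-irrefl : ∀ {n} (j : Fin (suc (suc n))) → next j ≢ j
next-irrefl j eq = prev-irrefl j (trans (cong prev (sym eq)) (prev-next j))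

-- Through `next²-irrefl` this tells the columns `j` and `j + 2` apart, which takes at least three
-- columns.
prev²-irrefl : ∀ {n} (j : Fin (suc (suc (suc n)))) → prev (prev j) ≢ j
prev²-irrefl zero ()
prev²-irrefl (suc zero) ()
prev²-irrefl (suc (suc j)) eq = contradiction (cong toℕ eq)
  (<⇒≢ (s≤s (≤-trans (≤-reflexive (trans (toℕ-inject₁ (inject₁ j)) (toℕ-inject₁ j))) (n≤1+n _))) )

next²-irrefl : ∀ {n} (j : Fin (suc (suc (suc n)))) → next (next j) ≢ j
next²-irrefl j eq = prev²-irrefl j
  (trans (cong (prev ∘ prev) (sym eq)) (trans (cong prev (prev-next (next j))) (prev-next j)))

next-stable : ∀ {n} {A : Set} (f : Fin (suc n) → A) → (∀ j → f (next j) ≡ f j) → ∀ j → f j ≡ f zero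
next-stable f st = <-weakInduction _ refl
  (λ i ih → trans (cong f (sym (next-inject₁ i))) (trans (st (inject₁ i)) ih))

∑-next : ∀ {n} (f : Fin (suc n) → ℕ) → ∑ (f ∘ next) ≡ ∑ f
∑-next {n} f = trans (∑-image next next-injective f) (∑-cong (λ e → trans
  (cong (_* f e) (trans (cong (fibre-size next next-injective) (sym (next-prev e)))
                        (fibre-size-image next next-injective (prev e)))) (*-identityˡ (f e))))

inject₁≢suc : ∀ {n} (b : Fin n) → inject₁ b ≢ suc b
inject₁≢suc b eq = suc≢inject₁ b (sym eq)

-- The hypotheses would place band `b` directly above band `b′` and also directly below it.
no-2-cycle : ∀ {n} (b b′ : Fin n) → inject₁ b ≡ suc b′ → suc b ≢ inject₁ b′
no-2-cycle b b′ p q = <⇒≢ (s≤s (n≤1+n _)) (trans lemma (cong suc (trans (sym (toℕ-inject₁ b)) (cong toℕ p))))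
  where
  lemma : toℕ b′ ≡ suc (toℕ b)
  lemma = sym (trans (cong toℕ q) (toℕ-inject₁ b′))

parity : ℕ → ℕ
parity zero    = 0
parity (suc x) = 1 ∸ parity x

parity≤1 : ∀ x → parity x ≤ 1
parity≤1 zero    = z≤n
parity≤1 (suc x) = m∸n≤m 1 (parity x)

parity-step : ∀ x → parity x + parity (suc x) ≡ 1
parity-step x = m+[n∸m]≡n (parity≤1 x)

-- Walks and cycles in a graph

module _ (G : Graph) where

  Adj-sym : ∀ {e u w} → Adj G e u w → Adj G e w u
  Adj-sym (inj₁ eq) = inj₂ eq
  Adj-sym (inj₂ eq) = inj₁ eq

  Reach-trans : ∀ {okE okV u v w} → Reach G okE okV u v → Reach G okE okV v w → Reach G okE okV u w
  Reach-trans here q = q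
  Reach-trans (step e oke okw adj p) q = step e oke okw adj (Reach-trans p q)

  Reach-sym : ∀ {okE okV u v} → okV u → Reach G okE okV u v → Reach G okE okV v u
  Reach-sym oku here = here
  Reach-sym oku (step e oke okw adj p) =
    Reach-trans (Reach-sym okw p) (step e oke oku (Adj-sym adj) here)

  Reach-weaken : ∀ {okE okV okV′ u v} → (∀ x → okV x → okV′ x) → Reach G okE okV u v → Reach G okE okV′ u v
  Reach-weaken f here = here
  Reach-weaken f (step e oke okw adj p) = step e oke (f _ okw) adj (Reach-weaken f p)

  tail head : Fin (m G) → Fin (n G)
  tail e = proj₁ (ends G e)
  head e = proj₂ (ends G e)

  inc : Fin (n G) → Fin (m G) → ℕ
  inc v e = ⟦ tail e ≟ v ⟧ + ⟦ head e ≟ v ⟧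

  -- The summand of deg is local to its definition; unification recovers it.
  deg-summand : ∀ C v → ∃ λ (f : Fin (m G) → ℕ) → deg G C v ≡ ∑ f
  deg-summand C v = _ , refl

  deg-summand≡ : ∀ C v e → proj₁ (deg-summand C v) e ≡ χ C e * inc v e
  deg-summand≡ C v e with e ∈? C
  ... | yes _ = sym (+-identityʳ _)
  ... | no _  = refl

  deg≡ : ∀ C v → deg G C v ≡ sumOver C (inc v)
  deg≡ C v = ∑-cong {m G} (deg-summand≡ C v)

  inc-Adj : ∀ {e u w} v → Adj G e u w → inc v e ≡ ⟦ u ≟ v ⟧ + ⟦ w ≟ v ⟧
  inc-Adj {e} v (inj₁ eq) rewrite eq = refl
  inc-Adj {e} {u} {w} v (inj₂ eq) rewrite eq = +-comm ⟦ w ≟ v ⟧ ⟦ u ≟ v ⟧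

  -- Double counting of incidences, weighted by `h` at the vertex. With a 2-colouring of the rings
  -- as `h` it yields the parity of the number of zigzag edges.
  handshake : ∀ C (h : Fin (n G) → ℕ) →
    ∑ (λ v → h v * deg G C v) ≡ sumOver C (λ e → h (tail e) + h (head e))
  handshake C h =
    trans (∑-cong (λ v → trans (cong (h v *_) (deg≡ C v)) (sym (∑-*ˡ {m G} (h v) _))))
    (trans (∑-swap (λ v e → h v * (χ C e * inc v e)))
    (∑-cong (λ e → trans (∑-cong (λ v → rearrange (h v) (χ C e) ⟦ tail e ≟ v ⟧ ⟦ head e ≟ v ⟧))
      (trans (∑-*ˡ {n G} (χ C e) _) (cong (χ C e *_) (trans (∑-+ (λ v → ⟦ tail e ≟ v ⟧ * h v) _)
        (cong₂ _+_ (∑-indicator (tail e) h) (∑-indicator (head e) h))))))))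
    where
    rearrange : ∀ a b c d → a * (b * (c + d)) ≡ b * (c * a + d * a)
    rearrange = solve-∀

  Incident : Fin (m G) → Fin (n G) → Set
  Incident e v = tail e ≡ v ⊎ head e ≡ v

  inc≢0⇒Incident : ∀ v e → inc v e ≢ 0 → Incident e v
  inc≢0⇒Incident v e ne with tail e ≟ v | head e ≟ v
  ... | yes p | _     = inj₁ p
  ... | no _  | yes q = inj₂ q
  ... | no _  | no _  = contradiction refl ne

  inc-loopless : ∀ v e → tail e ≢ head e → Incident e v → inc v e ≡ 1
  inc-loopless v e ne (inj₁ refl) = cong₂ _+_ (⟦yes⟧ (tail e ≟ v) refl) (⟦no⟧ (head e ≟ v) (ne ∘ sym))
  inc-loopless v e ne (inj₂ refl) = cong₂ _+_ (⟦no⟧ (tail e ≟ v) ne) (⟦yes⟧ (head e ≟ v) refl)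

  -- Without a second edge at `v`, the loopless `e` alone would give `v` degree 1.
  other-edge : ∀ C v e → deg G C v ≡ 0 ⊎ deg G C v ≡ 2 → tail e ≢ head e → e ∈ C → Incident e v →
    ∃ λ e′ → e′ ≢ e × e′ ∈ C × Incident e′ v
  other-edge C v e d ll e∈ i with any? (λ e′ → ¬? (e′ ≟ e) ×-dec ((e′ ∈? C) ×-dec ¬? (inc v e′ ℕ.≟ 0)))
  ... | yes (e′ , ne , e′∈ , i′) = e′ , ne , e′∈ , inc≢0⇒Incident v e′ i′
  ... | no none = contradiction d (bad (trans (deg≡ C v) (trans (∑-supported-at _ e off) at)))
    where
    off : ∀ e′ → e′ ≢ e → χ C e′ * inc v e′ ≡ 0
    off e′ ne with e′ ∈? C | inc v e′ ℕ.≟ 0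
    ... | no _   | _     = refl
    ... | yes _  | yes q = trans (+-identityʳ _) q
    ... | yes e∈ | no q  = contradiction (e′ , ne , e∈ , q) none
    at : χ C e * inc v e ≡ 1
    at = cong₂ _*_ (⟦yes⟧ (e ∈? C) e∈) (inc-loopless v e ll i)
    bad : deg G C v ≡ 1 → ¬ (deg G C v ≡ 0 ⊎ deg G C v ≡ 2)
    bad eq (inj₁ q) with trans (sym eq) q
    ... | ()
    bad eq (inj₂ q) with trans (sym eq) q
    ... | ()

  polygon-IsCycle : ∀ {p} (w : Fin (suc p) → Fin (n G)) (g : Fin (suc p) → Fin (m G)) →
    Inj w → Inj g → (∀ i → Adj G (g i) (w i) (w (next i))) → IsCycle G (image g)
  polygon-IsCycle {p} w g w-inj g-inj adj = (g zero , ∈-image⁺ g zero) , degrees , connected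
    where
    C = image g
    -- Corner `w i` is met by side `i` and by the side before it. Reindexing by `next` turns the
    -- second contribution into a copy of the first.
    deg-twice : ∀ v → deg G C v ≡ 2 * fibre-size w w-inj v
    deg-twice v = trans (deg≡ C v)
      (trans (sumOver-bijection C (inc v) g g-inj (∈-image⁺ g) (∈-image⁻ g))
      (trans (∑-cong (λ i → inc-Adj v (adj i)))
      (trans (∑-+ (λ i → ⟦ w i ≟ v ⟧) (λ i → ⟦ w (next i) ≟ v ⟧))
      (trans (cong (∑ (λ i → ⟦ w i ≟ v ⟧) +_) (∑-next (λ i → ⟦ w i ≟ v ⟧)))
             (sym (cong (fibre-size w w-inj v +_) (+-identityʳ _)))))))
    degrees : ∀ v → deg G C v ≡ 0 ⊎ deg G C v ≡ 2
    degrees v with any? (λ i → w i ≟ v)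
    ... | yes (i , refl) = inj₂ (trans (deg-twice v) (cong (2 *_) (fibre-size-image w w-inj i)))
    ... | no ¬i = inj₁ (trans (deg-twice v) (cong (2 *_) (fibre-size-empty w w-inj v ¬i)))
    R = Reach G (_∈ C) (λ _ → ⊤)
    from-base : ∀ i → R (w zero) (w i)
    from-base = <-weakInduction _ here (λ i r → Reach-trans r
      (step (g (inject₁ i)) (∈-image⁺ g (inject₁ i)) tt
        (subst (λ x → Adj G (g (inject₁ i)) (w (inject₁ i)) (w x)) (next-inject₁ i) (adj (inject₁ i))) here))
    to-tail : ∀ e → e ∈ C → R (w zero) (tail e)
    to-tail e e∈ with ∈-image⁻ g e e∈
    ... | i , refl with adj i
    ...   | inj₁ eq = subst (R (w zero)) (sym (cong proj₁ eq)) (from-base i)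
    ...   | inj₂ eq = subst (R (w zero)) (sym (cong proj₁ eq)) (from-base (next i))
    connected : ∀ e e′ → e ∈ C → e′ ∈ C → R (tail e) (tail e′)
    connected e e′ e∈ e′∈ = Reach-trans (Reach-sym tt (to-tail e e∈)) (to-tail e′ e′∈)

-- Multiplicities in lists

sumL : ∀ {A : Set} → (A → ℕ) → List A → ℕ
sumL f []       = 0
sumL f (x ∷ xs) = f x + sumL f xs

module _ {A : Set} where

  sumL-cong : ∀ {f g : A → ℕ} {P : A → Set} {xs} → All P xs → (∀ x → P x → f x ≡ g x) → sumL f xs ≡ sumL g xs
  sumL-cong []       h = refl
  sumL-cong (p ∷ ps) h = cong₂ _+_ (h _ p) (sumL-cong ps h)

  sumL-+ : ∀ (f g : A → ℕ) xs → sumL (λ x → f x + g x) xs ≡ sumL f xs + sumL g xs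
  sumL-+ f g []       = refl
  sumL-+ f g (x ∷ xs) = trans (cong (f x + g x +_) (sumL-+ f g xs)) (interchange (f x) (g x) _ _)

  sumL-*ʳ : ∀ c (f : A → ℕ) xs → sumL (λ x → f x * c) xs ≡ sumL f xs * c
  sumL-*ʳ c f []       = refl
  sumL-*ʳ c f (x ∷ xs) = trans (cong (f x * c +_) (sumL-*ʳ c f xs)) (sym (*-distribʳ-+ c (f x) _))

  sumL-∑ : ∀ {m} (f : A → Fin m → ℕ) xs → sumL (λ x → ∑ (f x)) xs ≡ ∑ (λ e → sumL (λ x → f x e) xs)
  sumL-∑ {m} f []   = sym (∑-zero {m})
  sumL-∑ f (x ∷ xs) = trans (cong (∑ (f x) +_) (sumL-∑ f xs)) (sym (∑-+ (f x) _))

  sumL-++ : ∀ (f : A → ℕ) xs ys → sumL f (xs ++ ys) ≡ sumL f xs + sumL f ys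
  sumL-++ f []       ys = refl
  sumL-++ f (x ∷ xs) ys = trans (cong (f x +_) (sumL-++ f xs ys)) (sym (+-assoc (f x) _ _))

  sumL-replicate : ∀ (f : A → ℕ) c x → sumL f (replicate c x) ≡ c * f x
  sumL-replicate f zero    x = refl
  sumL-replicate f (suc c) x = cong (f x +_) (sumL-replicate f c x)

  sumL-↭ : ∀ (f : A → ℕ) {xs ys} → xs ↭ ys → sumL f xs ≡ sumL f ys
  sumL-↭ f Perm.refl         = refl
  sumL-↭ f (prep x p)   = cong (f x +_) (sumL-↭ f p)
  sumL-↭ f (swap x y p) = trans (cong (λ s → f x + (f y + s)) (sumL-↭ f p)) (left-comm (f x) (f y) _)
    where
    left-comm : ∀ a b c → a + (b + c) ≡ b + (a + c)
    left-comm = solve-∀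
  sumL-↭ f (Perm.trans p q)  = trans (sumL-↭ f p) (sumL-↭ f q)

  -- The other entries already sum to at least `c` each, so a single entry above `c` would push the
  -- total over the bound.
  sumL-tight : ∀ (f : A → ℕ) c xs → All (λ x → c ≤ f x) xs → sumL f xs ≤ length xs * c → All (λ x → f x ≡ c) xs
  sumL-tight f c []       []       le = []
  sumL-tight f c (x ∷ xs) (p ∷ ps) le =
    ≤-antisym (+-cancelʳ-≤ _ (f x) c (≤-trans (+-monoʳ-≤ (f x) (lower xs ps)) le)) p ∷
    sumL-tight f c xs ps (+-cancelˡ-≤ c _ _ (≤-trans (+-monoˡ-≤ _ p) le))
    where
    lower : ∀ ys → All (λ y → c ≤ f y) ys → length ys * c ≤ sumL f ys
    lower []       []       = z≤n
    lower (y ∷ ys) (q ∷ qs) = +-mono-≤ q (lower ys qs)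

module Count {A : Set} (_≟ᴬ_ : DecidableEquality A) where

  count : A → List A → ℕ
  count x = sumL (λ y → ⟦ y ≟ᴬ x ⟧)

  count-self : ∀ x xs → count x (x ∷ xs) ≡ suc (count x xs)
  count-self x xs = cong (_+ count x xs) (⟦yes⟧ (x ≟ᴬ x) refl)

  0<count⇒∈ : ∀ x xs → 0 < count x xs → x List.∈ xs
  0<count⇒∈ x (y ∷ ys) lt with y ≟ᴬ x
  ... | yes refl = here refl
  ... | no _       = there (0<count⇒∈ x ys lt)

  ∉⇒count≡0 : ∀ x xs → ¬ (x List.∈ xs) → count x xs ≡ 0
  ∉⇒count≡0 x xs ∉ with count x xs in eq
  ... | zero  = refl
  ... | suc _ = contradiction (0<count⇒∈ x xs (subst (0 <_) (sym eq) (s≤s z≤n))) ∉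

  -- The head of `xs` occurs in `ys`; removing one occurrence from both lists keeps the counts
  -- equal.
  count⇒↭ : ∀ xs ys → (∀ x → count x xs ≡ count x ys) → xs ↭ ys
  count⇒↭ [] []       h = ↭-refl
  count⇒↭ [] (y ∷ ys) h with trans (h y) (count-self y ys)
  ... | ()
  count⇒↭ (x ∷ xs) ys h with ∈-∃++ (0<count⇒∈ x ys (subst (0 <_) (trans (sym (count-self x xs)) (h x)) (s≤s z≤n)))
  ... | as , bs , refl = ↭-trans
    (prep x (count⇒↭ xs (as ++ bs) (λ y → +-cancelˡ-≡ ⟦ x ≟ᴬ y ⟧ _ _
      (trans (h y) (sumL-↭ (λ z → ⟦ z ≟ᴬ y ⟧) (shift x as bs))))))
    (↭-sym (shift x as bs))

  count≤1⇒Unique : ∀ xs → (∀ x → count x xs ≤ 1) → Unique xs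
  count≤1⇒Unique []       h = []
  count≤1⇒Unique (x ∷ xs) h =
    All.tabulate (λ {y} y∈ x≡y → <⇒≱ (≤-trans (s≤s (∈⇒0<count y∈)) (≤-reflexive (sym (count-self y xs))))
                                     (subst (λ z → count y (z ∷ xs) ≤ 1) x≡y (h y))) ∷
    count≤1⇒Unique xs (λ y → ≤-trans (m≤n+m _ _) (h y))
    where
    ∈⇒0<count : ∀ {y ys} → y List.∈ ys → 0 < count y ys
    ∈⇒0<count {y} {ys = z ∷ zs} (here refl) = subst (0 <_) (sym (count-self y zs)) (s≤s z≤n)
    ∈⇒0<count (there p) = ≤-trans (∈⇒0<count p) (m≤n+m _ _)

  Unique⇒count≤1 : ∀ {xs} → Unique xs → ∀ x → count x xs ≤ 1
  Unique⇒count≤1 [] x = z≤n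
  Unique⇒count≤1 {y ∷ ys} (py ∷ u) x with y ≟ᴬ x
  ... | yes refl = s≤s (≤-reflexive (∉⇒count≡0 y ys (λ y∈ → All.lookup py y∈ refl)))
  ... | no _ = Unique⇒count≤1 u x

module _ {A : Set} where

  fromMultiplicities : ∀ {p} → (Fin p → A) → (Fin p → ℕ) → List A
  fromMultiplicities {zero}  h μ = []
  fromMultiplicities {suc p} h μ = replicate (μ zero) (h zero) ++ fromMultiplicities (h ∘ suc) (μ ∘ suc)

  sumL-fromMultiplicities : ∀ {p} (f : A → ℕ) (h : Fin p → A) μ →
    sumL f (fromMultiplicities h μ) ≡ ∑ (λ i → μ i * f (h i))
  sumL-fromMultiplicities {zero}  f h μ = refl
  sumL-fromMultiplicities {suc p} f h μ = trans (sumL-++ f (replicate (μ zero) (h zero)) _)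
    (cong₂ _+_ (sumL-replicate f (μ zero) (h zero)) (sumL-fromMultiplicities f (h ∘ suc) (μ ∘ suc)))

  length-fromMultiplicities : ∀ {p} (h : Fin p → A) μ → length (fromMultiplicities h μ) ≡ ∑ μ
  length-fromMultiplicities {zero}  h μ = refl
  length-fromMultiplicities {suc p} h μ = trans (length-++ (replicate (μ zero) (h zero)))
    (cong₂ _+_ (length-replicate (μ zero)) (length-fromMultiplicities (h ∘ suc) (μ ∘ suc)))

  All-fromMultiplicities : ∀ {p} {P : A → Set} (h : Fin p → A) μ → (∀ i → P (h i)) → All P (fromMultiplicities h μ)
  All-fromMultiplicities {zero}  h μ q = []
  All-fromMultiplicities {suc p} h μ q =
    All.++⁺ (All.replicate⁺ (μ zero) (q zero)) (All-fromMultiplicities (h ∘ suc) (μ ∘ suc) (q ∘ suc))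

cover≡sumL : ∀ (G : Graph) e xs → cover G e xs ≡ sumL (λ C → χ C e) xs
cover≡sumL G e []       = refl
cover≡sumL G e (C ∷ xs) with e ∈? C
... | yes _ = cong suc (cover≡sumL G e xs)
... | no _  = cover≡sumL G e xs

-- Descending sequences

-- The terms on either side of gap i in the sequence v, a 0, …, a (L - 1), 0.
before : ∀ {L} → ℕ → (Fin L → ℕ) → Fin (suc L) → ℕ
before v a zero    = v
before v a (suc b) = a b

after : ∀ {L} → (Fin L → ℕ) → Fin (suc L) → ℕ
after {zero}  a zero    = 0
after {suc L} a zero    = a zero
after {suc L} a (suc i) = after (a ∘ suc) i

after-inject₁ : ∀ {L} (a : Fin L → ℕ) b → after a (inject₁ b) ≡ a b
after-inject₁ a zero    = refl
after-inject₁ a (suc b) = after-inject₁ (a ∘ suc) b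

after-fromℕ : ∀ {L} (a : Fin L → ℕ) → after a (fromℕ L) ≡ 0
after-fromℕ {zero}  a = refl
after-fromℕ {suc L} a = after-fromℕ (a ∘ suc)

after-cong : ∀ {L} {a a′ : Fin L → ℕ} → (∀ b → a b ≡ a′ b) → ∀ i → after a i ≡ after a′ i
after-cong {zero}  h zero    = refl
after-cong {suc L} h zero    = h zero
after-cong {suc L} h (suc i) = after-cong (h ∘ suc) i

before-cong : ∀ {L} v {a a′ : Fin L → ℕ} → (∀ b → a b ≡ a′ b) → ∀ i → before v a i ≡ before v a′ i
before-cong v h zero    = refl
before-cong v h (suc b) = h b

Descending : ∀ {L} → ℕ → (Fin L → ℕ) → Set
Descending v a = ∀ i → after a i ≤ before v a i

before-tail : ∀ {L} v (a : Fin (suc L) → ℕ) i → before v a (suc i) ≡ before (a zero) (a ∘ suc) i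
before-tail v a zero    = refl
before-tail v a (suc i) = refl

Descending-tail : ∀ {L v} {a : Fin (suc L) → ℕ} → Descending v a → Descending (a zero) (a ∘ suc)
Descending-tail {v = v} {a} d i = ≤-trans (d (suc i)) (≤-reflexive (before-tail v a i))

Descending-cons : ∀ {L v} {a : Fin (suc L) → ℕ} → a zero ≤ v → Descending (a zero) (a ∘ suc) → Descending v a
Descending-cons le d zero = le
Descending-cons {v = v} {a} le d (suc i) = ≤-trans (d i) (≤-reflexive (sym (before-tail v a i)))

Descending⇒≤ : ∀ {L} v (a : Fin L → ℕ) → Descending v a → ∀ b → a b ≤ v
Descending⇒≤ v a d zero    = d zero
Descending⇒≤ v a d (suc b) = ≤-trans (Descending⇒≤ (a zero) (a ∘ suc) (Descending-tail d) b) (d zero)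

-- The drops telescope from `v` down to 0.
∑-drops : ∀ {L} v (a : Fin L → ℕ) → Descending v a → ∑ (λ i → before v a i ∸ after a i) ≡ v
∑-drops {zero}  v a d = +-identityʳ v
∑-drops {suc L} v a d =
  trans (cong (v ∸ a zero +_) (trans (∑-cong (λ i → cong (_∸ after (a ∘ suc) i) (before-tail v a i)))
                                         (∑-drops (a zero) (a ∘ suc) (Descending-tail d))))
          (m∸n+n≡m (d zero))

-- The binomial coefficient `L + v` choose `v`, which counts the descending sequences of length `L`
-- with values at most `v`. The recursion asks whether the first term falls short of the maximum or
-- attains it.
#desc : ℕ → ℕ → ℕ
#desc zero    v       = 1
#desc (suc L) zero    = #desc L zero
#desc (suc L) (suc v) = #desc (suc L) v + #desc L (suc v)

-- Ranks a sequence along the recursion of `#desc`: sequences starting below the maximum fill the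
-- left block, those starting at the maximum the right one.
code : ∀ {L} v → (Fin L → ℕ) → Fin (#desc L v)
code {zero}  v       a = zero
code {suc L} zero    a = code zero (a ∘ suc)
code {suc L} (suc v) a with a zero ℕ.≟ suc v
... | yes _ = #desc (suc L) v ↑ʳ code (suc v) (a ∘ suc)
... | no _  = code v a ↑ˡ #desc L (suc v)

code-cong : ∀ {L} v {a a′ : Fin L → ℕ} → (∀ b → a b ≡ a′ b) → code v a ≡ code v a′
code-cong {zero}  v    h = refl
code-cong {suc L} zero h = code-cong zero (h ∘ suc)
code-cong {suc L} (suc v) {a} {a′} h with a zero ℕ.≟ suc v | a′ zero ℕ.≟ suc v
... | yes _ | yes _ = cong (#desc (suc L) v ↑ʳ_) (code-cong (suc v) (h ∘ suc))
... | no _  | no _  = cong (_↑ˡ #desc L (suc v)) (code-cong v h)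
... | yes p | no ¬p = contradiction (trans (sym (h zero)) p) ¬p
... | no ¬p | yes p = contradiction (trans (h zero) p) ¬p

↑ˡ≢↑ʳ : ∀ {m n} (i : Fin m) (j : Fin n) → i ↑ˡ n ≢ m ↑ʳ j
↑ˡ≢↑ʳ {m} {n} i j eq with trans (sym (splitAt-↑ˡ m i n)) (trans (cong (splitAt m) eq) (splitAt-↑ʳ m n j))
... | ()

lower-head : ∀ {L v} {a : Fin (suc L) → ℕ} → Descending (suc v) a → a zero ≢ suc v → Descending v a
lower-head d ne = Descending-cons (≤-pred (≤∧≢⇒< (d zero) ne)) (Descending-tail d)

code-injective : ∀ {L} v {a a′ : Fin L → ℕ} → Descending v a → Descending v a′ → code v a ≡ code v a′ → ∀ b → a b ≡ a′ b
code-injective {suc L} zero {a} {a′} d d′ eq = λ where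
    zero    → trans z (sym z′)
    (suc b) → code-injective zero (subst (λ x → Descending x (a ∘ suc)) z (Descending-tail d))
                                  (subst (λ x → Descending x (a′ ∘ suc)) z′ (Descending-tail d′)) eq b
  where
  z  = n≤0⇒n≡0 (d zero)
  z′ = n≤0⇒n≡0 (d′ zero)
code-injective {suc L} (suc v) {a} {a′} d d′ eq with a zero ℕ.≟ suc v | a′ zero ℕ.≟ suc v
... | yes p | yes p′ = λ where
  zero    → trans p (sym p′)
  (suc b) → code-injective (suc v) (subst (λ x → Descending x (a ∘ suc)) p (Descending-tail d))
              (subst (λ x → Descending x (a′ ∘ suc)) p′ (Descending-tail d′)) (↑ʳ-injective (#desc (suc L) v) _ _ eq) b
... | no p  | no p′ = code-injective v (lower-head d p) (lower-head d′ p′) (↑ˡ-injective (#desc L (suc v)) _ _ eq)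
... | yes _ | no _  = contradiction (sym eq) (↑ˡ≢↑ʳ _ _)
... | no _  | yes _ = contradiction eq (↑ˡ≢↑ʳ _ _)

-- The block that contains `c` tells whether the sequence starts with the maximum or is bounded by
-- the next smaller value.
code-surjective : ∀ {L} v (c : Fin (#desc L v)) → ∃ λ (a : Fin L → ℕ) → Descending v a × code v a ≡ c
code-surjective {zero} v zero = (λ ()) , (λ { zero → z≤n }) , refl
code-surjective {suc L} zero c with code-surjective zero c
... | a , d , eq = extend 0 a , Descending-cons z≤n d , eq
code-surjective {suc L} (suc v) c with splitAt (#desc (suc L) v) c in s
... | inj₁ c′ = case (code-surjective v c′)
  where
  case : (∃ λ a → Descending v a × code v a ≡ c′) → ∃ λ a → Descending (suc v) a × code (suc v) a ≡ c
  case (a , d , eq) = a , Descending-cons (≤-trans (d zero) (n≤1+n v)) (Descending-tail d) , lemma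
    where
    lemma : code (suc v) a ≡ c
    lemma with a zero ℕ.≟ suc v
    ... | yes p = contradiction (subst (_≤ v) p (d zero)) (<⇒≱ ≤-refl)
    ... | no _  = trans (cong (_↑ˡ #desc L (suc v)) eq)
      (trans (cong (join (#desc (suc L) v) (#desc L (suc v))) (sym s)) (join-splitAt (#desc (suc L) v) _ c))
... | inj₂ c′ with code-surjective (suc v) c′
...   | a , d , eq = extend (suc v) a , Descending-cons ≤-refl d , lemma
  where
  lemma : code (suc v) (extend (suc v) a) ≡ c
  lemma with suc v ℕ.≟ suc v
  ... | no p  = contradiction refl p
  ... | yes _ = trans (cong (#desc (suc L) v ↑ʳ_) eq)
      (trans (cong (join (#desc (suc L) v) (#desc L (suc v))) (sym s)) (join-splitAt (#desc (suc L) v) _ c))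

-- Triangular numbers: `#desc L 1` is `suc L`, and `#desc L 2` adds these up. Doubling keeps the
-- division out of the induction.
#desc-2 : ∀ L → #desc L 2 ≡ (suc L * suc (suc L)) / 2
#desc-2 L = trans (sym (m*n/n≡m (#desc L 2) 2)) (cong (_/ 2) (two L))
  where
  zero′ : ∀ L → #desc L 0 ≡ 1
  zero′ zero    = refl
  zero′ (suc L) = zero′ L
  one : ∀ L → #desc L 1 ≡ suc L
  one zero    = refl
  one (suc L) = cong₂ _+_ (zero′ L) (one L)
  arith : ∀ L x → x * 2 ≡ suc L * suc (suc L) → (suc (suc L) + x) * 2 ≡ suc (suc L) * suc (suc (suc L))
  arith L x h = trans (*-distribʳ-+ 2 (suc (suc L)) x) (trans (cong (suc (suc L) * 2 +_) h) (p L))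
    where
    p : ∀ L → suc (suc L) * 2 + suc L * suc (suc L) ≡ suc (suc L) * suc (suc (suc L))
    p = solve-∀
  two : ∀ L → #desc L 2 * 2 ≡ suc L * suc (suc L)
  two zero    = refl
  two (suc L) = trans (cong (λ y → (y + #desc L 2) * 2) (one (suc L))) (arith L (#desc L 2) (two L))

-- Orbits

module _ {A : Set} {f : A → A} where

  iterate-+ : ∀ i j x → iterate f (i + j) x ≡ iterate f i (iterate f j x)
  iterate-+ zero    j x = refl
  iterate-+ (suc i) j x = cong f (iterate-+ i j x)

  stay : ∀ {x y} → x ≡ y → SameOrbit f x y
  stay eq = 0 , eq

  once : ∀ {x y} → f x ≡ y → SameOrbit f x y
  once eq = 1 , eq

  infixr 5 _▸_
  _▸_ : ∀ {x y z} → SameOrbit f x y → SameOrbit f y z → SameOrbit f x z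
  _▸_ {x} (i , refl) (j , refl) = j + i , iterate-+ j i x

SameOrbit-map : ∀ {A B : Set} {f : A → A} {g : B → B} (h : A → B) → (∀ x → h (f x) ≡ g (h x)) →
  ∀ {x y} → SameOrbit f x y → SameOrbit g (h x) (h y)
SameOrbit-map {f = f} {g} h comm {x} (i , refl) = i , sym (conj i)
  where
  conj : ∀ i → h (iterate f i x) ≡ iterate g i (h x)
  conj zero    = refl
  conj (suc i) = trans (comm _) (cong g (conj i))

next-transitive : ∀ {n} (i j : Fin (suc n)) → SameOrbit next i j
-- Climb to the last index, wrap around to zero, and climb again to `j`.
next-transitive {n} i j = up i ▸ once (next-fromℕ n) ▸ from-zero j
  where
  from-zero : ∀ j → SameOrbit next zero j
  from-zero = <-weakInduction _ (stay refl) (λ x o → o ▸ once (next-inject₁ x))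
  up : ∀ i → SameOrbit next i (fromℕ n)
  up = >-weakInduction _ (stay refl) (λ x o → once (next-inject₁ x) ▸ o)

prev-transitive : ∀ {n} (i j : Fin (suc n)) → SameOrbit prev i j
prev-transitive {n} i j = down i ▸ once refl ▸ from-top j
  where
  down : ∀ j → SameOrbit prev j zero
  down = <-weakInduction _ (stay refl) (λ x o → once refl ▸ o)
  from-top : ∀ i → SameOrbit prev (fromℕ n) i
  from-top = >-weakInduction _ (stay refl) (λ x o → o ▸ once refl)

-- Classes may be counted by any complete invariant with values in a finite type, once each value
-- has a representative.
NumClasses-via : ∀ {A B : Set} {_~_ : A → A → Set} {N} (B↔ : B ↔ Fin N) (cls : A → B) (rep : B → A) →
  (∀ b → cls (rep b) ≡ b) → (∀ {x y} → x ~ y → cls x ≡ cls y) → (∀ x y → cls x ≡ cls y → x ~ y) → NumClasses A _~_ N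
NumClasses-via B↔ cls rep cls-rep sound complete =
  (Inverse.to B↔ ∘ cls) ,
  (λ j → rep (Inverse.from B↔ j) , trans (cong (Inverse.to B↔) (cls-rep _)) (Inverse.strictlyInverseˡ B↔ j)) ,
  (λ x y → mk⇔ (λ eq → complete x y (trans (sym (Inverse.strictlyInverseʳ B↔ (cls x)))
                          (trans (cong (Inverse.from B↔) eq) (Inverse.strictlyInverseʳ B↔ (cls y)))))
               (λ o → cong (Inverse.to B↔) (sound o)))

-- The stack of antiprisms

module Stack (L′ k′ : ℕ) where

  L ℓ k : ℕ
  L = suc L′
  ℓ = suc L
  k = 3 + k′

  -- Edges, shapes and faces each consist of two families indexed by band and column and one extra
  -- part: the ring edges, the rings, or the two outer faces. A common type lets them share their
  -- enumeration and the splitting of sums.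
  Cell : Set → Set
  Cell A = A ⊎ (Fin L × Fin k) ⊎ (Fin L × Fin k)

  V Edge Shape : Set
  V     = Fin ℓ × Fin k
  Edge  = Cell V
  Shape = Cell (Fin ℓ)

  -- ring i j joins (i , j) to (i , j + 1); in band b, which lies between rings b and b + 1,
  -- s b j joins (b , j) to (b + 1 , j) and t b j joins (b , j + 1) to (b + 1 , j).
  pattern ring i j = inj₁ (i , j)
  pattern s b j    = inj₂ (inj₁ (b , j))
  pattern t b j    = inj₂ (inj₂ (b , j))

  -- The rings, and the triangles on ring b (U, pointing up) and on ring b + 1 (D, pointing down).
  pattern R i   = inj₁ i
  pattern U b j = inj₂ (inj₁ (b , j))
  pattern D b j = inj₂ (inj₂ (b , j))

  cell₀ : ∀ {A a} → A ↔ Fin a → Cell A ↔ Fin (a + (L * k + L * k))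
  cell₀ A↔ = ↔-trans (A↔ ⊎-↔ (↔-sym *↔× ⊎-↔ ↔-sym *↔×)) (↔-trans (↔-refl ⊎-↔ ↔-sym +↔⊎) (↔-sym +↔⊎))

  ∑-cell₀ : ∀ {A a} (A↔ : A ↔ Fin a) (f : Cell A → ℕ) →
    ∑ (λ e → f (Inverse.from (cell₀ A↔) e)) ≡
    ∑ (λ x → f (inj₁ (Inverse.from A↔ x))) +
    (∑ {L * k} (λ y → f (inj₂ (inj₁ (remQuot k y)))) + ∑ {L * k} (λ y → f (inj₂ (inj₂ (remQuot k y)))))
  ∑-cell₀ {A} {a} A↔ f = trans (trans (∑-cong eq) (∑-splitAt a F))
    (cong (∑ (λ x → f (inj₁ (Inverse.from A↔ x))) +_) (∑-splitAt (L * k) F₂))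
    where
    F₂ : Fin (L * k) ⊎ Fin (L * k) → ℕ
    F₂ (inj₁ y) = f (inj₂ (inj₁ (remQuot k y)))
    F₂ (inj₂ y) = f (inj₂ (inj₂ (remQuot k y)))
    F : Fin a ⊎ Fin (L * k + L * k) → ℕ
    F (inj₁ x) = f (inj₁ (Inverse.from A↔ x))
    F (inj₂ y) = F₂ (splitAt (L * k) y)
    eq : ∀ e → f (Inverse.from (cell₀ A↔) e) ≡ F (splitAt a e)
    eq e with splitAt a e
    ... | inj₁ x = refl
    ... | inj₂ y with splitAt (L * k) y
    ...   | inj₁ _ = refl
    ...   | inj₂ _ = refl

  -- Abstract, since sums over Fin (ℓ * k) would otherwise be unfolded.
  abstract
    #V : ℕ
    #V = ℓ * k

    #V≡ : #V ≡ ℓ * k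
    #V≡ = refl

    cells : ℕ → ℕ
    cells a = a + (L * k + L * k)

    cells≡ : ∀ a → cells a ≡ a + (L * k + L * k)
    cells≡ a = refl

    vertex : V ↔ Fin #V
    vertex = ↔-sym *↔×

    cell : ∀ {A a} → A ↔ Fin a → Cell A ↔ Fin (cells a)
    cell = cell₀

    ∑-cell : ∀ {A a} (A↔ : A ↔ Fin a) (f : Cell A → ℕ) →
      ∑ (λ e → f (Inverse.from (cell A↔) e)) ≡
      ∑ (λ x → f (inj₁ (Inverse.from A↔ x))) +
      (∑ {L * k} (λ y → f (inj₂ (inj₁ (remQuot k y)))) + ∑ {L * k} (λ y → f (inj₂ (inj₂ (remQuot k y)))))
    ∑-cell = ∑-cell₀

  edge : Edge ↔ Fin (cells #V)
  edge = cell vertex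

  encV : V → Fin #V
  encV = Inverse.to vertex

  decV : Fin #V → V
  decV = Inverse.from vertex

  enc : Edge → Fin (cells #V)
  enc = Inverse.to edge

  dec : Fin (cells #V) → Edge
  dec = Inverse.from edge

  enc-dec : ∀ e → enc (dec e) ≡ e
  enc-dec = Inverse.strictlyInverseˡ edge

  dec-enc : ∀ x → dec (enc x) ≡ x
  dec-enc = Inverse.strictlyInverseʳ edge

  decV-encV : ∀ v → decV (encV v) ≡ v
  decV-encV = Inverse.strictlyInverseʳ vertex

  encV-decV : ∀ v → encV (decV v) ≡ v
  encV-decV = Inverse.strictlyInverseˡ vertex

  enc-injective : Inj enc
  enc-injective eq = trans (sym (dec-enc _)) (trans (cong dec eq) (dec-enc _))

  encV-injective : Inj encV
  encV-injective eq = trans (sym (decV-encV _)) (trans (cong decV eq) (decV-encV _))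

  Zig : Set
  Zig = (Fin L × Fin k) ⊎ (Fin L × Fin k)

  band : Zig → Fin L
  band (inj₁ (b , _)) = b
  band (inj₂ (b , _)) = b

  foot apex : Zig → Fin k
  foot (inj₁ (_ , j)) = j
  foot (inj₂ (_ , j)) = next j
  apex (inj₁ (_ , j)) = j
  apex (inj₂ (_ , j)) = j

  tailE headE : Edge → V
  tailE (ring i j) = i , j
  tailE (inj₂ z)   = inject₁ (band z) , foot z
  headE (ring i j) = i , next j
  headE (inj₂ z)   = suc (band z) , apex z

  G : Graph
  G = record { n = #V ; m = cells #V ; ends = λ e → encV (tailE (dec e)) , encV (headE (dec e)) }

  ends-enc : ∀ x → ends G (enc x) ≡ (encV (tailE x) , encV (headE x))
  ends-enc x = cong (λ y → encV (tailE y) , encV (headE y)) (dec-enc x)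

  adjacent : ∀ x → Adj G (enc x) (encV (tailE x)) (encV (headE x))
  adjacent x = inj₁ (ends-enc x)

  -- One less than the number of corners, so that the corners are indexed by a type on which `next`
  -- is defined.
  corners : Shape → ℕ
  corners (R i)   = 2 + k′
  corners (U b j) = 2
  corners (D b j) = 2

  corner : ∀ x → Fin (suc (corners x)) → V
  corner (R i)   j = i , j
  corner (U b j)   = three (inject₁ b , j) (inject₁ b , next j) (suc b , j)
  corner (D b j)   = three (suc b , j) (suc b , next j) (inject₁ b , next j)

  side : ∀ x → Fin (suc (corners x)) → Edge
  side (R i)   j = ring i j
  side (U b j)   = three (ring (inject₁ b) j) (t b j) (s b j)
  side (D b j)   = three (ring (suc b) j) (s b (next j)) (t b j)

  corner-injective : ∀ x → Inj (corner x)
  corner-injective (R i) refl = refl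
  corner-injective (U b j) = three-injective (λ eq → next-irrefl j (sym (cong proj₂ eq)))
    (λ eq → inject₁≢suc b (cong proj₁ eq)) (λ eq → inject₁≢suc b (cong proj₁ eq))
  corner-injective (D b j) = three-injective (λ eq → next-irrefl j (sym (cong proj₂ eq)))
    (λ eq → inject₁≢suc b (sym (cong proj₁ eq))) (λ eq → inject₁≢suc b (sym (cong proj₁ eq)))

  side-injective : ∀ x → Inj (side x)
  side-injective (R i) refl = refl
  side-injective (U b j) = three-injective (λ ()) (λ ()) (λ ())
  side-injective (D b j) = three-injective (λ ()) (λ ()) (λ ())

  -- Zigzag edges are always directed upwards, so on the way around a triangle one of its two is
  -- traversed backwards.
  side-ends : ∀ x i → (tailE (side x i) ≡ corner x i × headE (side x i) ≡ corner x (next i)) ⊎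
                      (tailE (side x i) ≡ corner x (next i) × headE (side x i) ≡ corner x i)
  side-ends (R i) j = inj₁ (refl , refl)
  side-ends (U b j) zero = inj₁ (refl , refl)
  side-ends (U b j) (suc zero) = inj₁ (refl , refl)
  side-ends (U b j) (suc (suc zero)) = inj₂ (refl , refl)
  side-ends (D b j) zero = inj₁ (refl , refl)
  side-ends (D b j) (suc zero) = inj₂ (refl , refl)
  side-ends (D b j) (suc (suc zero)) = inj₁ (refl , refl)

  sides : Shape → Subset (m G)
  sides x = image (enc ∘ side x)

  side∈ : ∀ x i → enc (side x i) ∈ sides x
  side∈ x = ∈-image⁺ (enc ∘ side x)

  ∈sides : ∀ x e → enc e ∈ sides x → ∃ λ i → side x i ≡ e
  ∈sides x e e∈ with ∈-image⁻ (enc ∘ side x) (enc e) e∈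
  ... | i , eq = i , enc-injective eq

  sides-IsCycle : ∀ x → IsCycle G (sides x)
  sides-IsCycle x = polygon-IsCycle G (encV ∘ corner x) (enc ∘ side x)
    (λ eq → corner-injective x (encV-injective eq)) (λ eq → side-injective x (enc-injective eq)) adj
    where
    adj : ∀ i → Adj G (enc (side x i)) (encV (corner x i)) (encV (corner x (next i)))
    adj i with side-ends x i
    ... | inj₁ (p , q) = inj₁ (trans (ends-enc (side x i)) (cong₂ (λ u v → encV u , encV v) p q))
    ... | inj₂ (p , q) = inj₂ (trans (ends-enc (side x i)) (cong₂ (λ u v → encV u , encV v) p q))

  isRing isZig : Edge → ℕ
  isRing (ring _ _) = 1
  isRing (inj₂ _)   = 0
  isZig (ring _ _) = 0
  isZig (inj₂ _)   = 1

  loopless : ∀ x → tailE x ≢ headE x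
  loopless (ring i j) eq = next-irrefl j (sym (cong proj₂ eq))
  loopless (inj₂ z)   eq = inject₁≢suc (band z) (cong proj₁ eq)

  -- Incidences of ring and zigzag edges.

  At : Edge → V → Set
  At x v = tailE x ≡ v ⊎ headE x ≡ v

  ring-row : ∀ {i j v} → At (ring i j) v → i ≡ proj₁ v
  ring-row (inj₁ refl) = refl
  ring-row (inj₂ refl) = refl

  zig-row : ∀ z {v w} → At (inj₂ z) v → At (inj₂ z) w → proj₁ v ≡ proj₁ w → v ≡ w
  zig-row z (inj₁ refl) (inj₁ refl) eq = refl
  zig-row z (inj₂ refl) (inj₂ refl) eq = refl
  zig-row z (inj₁ refl) (inj₂ refl) eq = contradiction eq (inject₁≢suc (band z))
  zig-row z (inj₂ refl) (inj₁ refl) eq = contradiction (sym eq) (inject₁≢suc (band z))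

  zig-determined : ∀ z z′ → tailE (inj₂ z) ≡ tailE (inj₂ z′) → headE (inj₂ z) ≡ headE (inj₂ z′) → z ≡ z′
  zig-determined (inj₁ _) (inj₁ _)       p refl = refl
  zig-determined (inj₂ _) (inj₂ _)       p refl = refl
  zig-determined (inj₁ _) (inj₂ (_ , j)) p refl = contradiction (sym (cong proj₂ p)) (next-irrefl j)
  zig-determined (inj₂ _) (inj₁ (_ , j)) p refl = contradiction (cong proj₂ p) (next-irrefl j)

  -- No edge is parallel to a zigzag edge: a ring edge stays in its ring, and an `s` and a `t` edge
  -- with the same head have tails in different columns.
  zig-simple : ∀ z y → At y (tailE (inj₂ z)) → At y (headE (inj₂ z)) → y ≡ inj₂ z
  zig-simple z (ring _ _) p q = contradiction (trans (sym (ring-row p)) (ring-row q)) (inject₁≢suc (band z))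
  zig-simple z (inj₂ y) (inj₁ p) (inj₂ q) = cong inj₂ (zig-determined y z p q)
  zig-simple z (inj₂ y) (inj₁ p) (inj₁ q) = contradiction (trans (sym p) q) (loopless (inj₂ z))
  zig-simple z (inj₂ y) (inj₂ p) (inj₂ q) = contradiction (trans (sym p) q) (loopless (inj₂ z))
  zig-simple z (inj₂ y) (inj₂ p) (inj₁ q) =
    contradiction (sym (cong proj₁ q)) (no-2-cycle (band z) (band y) (sym (cong proj₁ p)))

  -- By `no-2-cycle` both zigzag edges lead to the same side of ring `i`. Comparing the columns at
  -- which they meet then leaves one combination of an `s` and a `t` edge on each side.
  triangle : ∀ i j z z′ {v} → At (inj₂ z) (i , j) → At (inj₂ z′) (i , next j) →
    At (inj₂ z) v → At (inj₂ z′) v → proj₁ v ≢ i →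
    (∃ λ b → i ≡ inject₁ b × z ≡ inj₁ (b , j) × z′ ≡ inj₂ (b , j)) ⊎
    (∃ λ b → i ≡ suc b × z ≡ inj₂ (b , j) × z′ ≡ inj₁ (b , next j))
  triangle i j z z′ (inj₁ refl) _ (inj₁ refl) _ ne = contradiction refl ne
  triangle i j z z′ (inj₂ refl) _ (inj₂ refl) _ ne = contradiction refl ne
  triangle i j z z′ _ (inj₁ p) _ (inj₁ q) ne = contradiction (cong proj₁ (trans (sym q) p)) ne
  triangle i j z z′ _ (inj₂ p) _ (inj₂ q) ne = contradiction (cong proj₁ (trans (sym q) p)) ne
  triangle i j z z′ (inj₁ refl) (inj₂ p) (inj₂ refl) (inj₁ q) ne =
    contradiction (sym (cong proj₁ q)) (no-2-cycle (band z) (band z′) (sym (cong proj₁ p)))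
  triangle i j z z′ (inj₂ refl) (inj₁ p) (inj₁ refl) (inj₂ q) ne =
    contradiction (sym (cong proj₁ p)) (no-2-cycle (band z) (band z′) (sym (cong proj₁ q)))
  triangle i j (inj₁ (b , _)) (inj₁ _) (inj₁ refl) (inj₁ p) (inj₂ refl) (inj₂ refl) ne =
    contradiction (sym (cong proj₂ p)) (next-irrefl j)
  triangle i j (inj₁ (b , _)) (inj₂ _) (inj₁ refl) (inj₁ p) (inj₂ refl) (inj₂ refl) ne =
    inj₁ (b , refl , refl , refl)
  triangle i j (inj₂ (b , x)) (inj₁ _) (inj₁ refl) (inj₁ p) (inj₂ refl) (inj₂ refl) ne =
    contradiction (sym (cong proj₂ p)) (next²-irrefl x)
  triangle i j (inj₂ (b , x)) (inj₂ _) (inj₁ refl) (inj₁ p) (inj₂ refl) (inj₂ refl) ne =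
    contradiction (sym (next-injective (cong proj₂ p))) (next-irrefl x)
  triangle i j (inj₁ (b , _)) (inj₁ _) (inj₂ refl) (inj₂ refl) (inj₁ refl) (inj₁ q) ne =
    contradiction (cong proj₂ q) (next-irrefl j)
  triangle i j (inj₁ (b , _)) (inj₂ _) (inj₂ refl) (inj₂ refl) (inj₁ refl) (inj₁ q) ne =
    contradiction (cong proj₂ q) (next²-irrefl j)
  triangle i j (inj₂ (b , _)) (inj₁ _) (inj₂ refl) (inj₂ refl) (inj₁ refl) (inj₁ q) ne =
    inj₂ (b , refl , refl , refl)
  triangle i j (inj₂ (b , _)) (inj₂ _) (inj₂ refl) (inj₂ refl) (inj₁ refl) (inj₁ q) ne =
    contradiction (next-injective (cong proj₂ q)) (next-irrefl j)

  -- Weights of cycles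

  -- The weight `2 + k′` of a zigzag edge is `k - 1`.
  rings zigs weight : Subset (m G) → ℕ
  rings C  = sumOver C (isRing ∘ dec)
  zigs C   = sumOver C (isZig ∘ dec)
  weight C = sumOver C (λ e → 2 * isRing (dec e) + (2 + k′) * isZig (dec e))

  weight≡ : ∀ C → weight C ≡ 2 * rings C + (2 + k′) * zigs C
  weight≡ C = trans (sumOver-+ C _ _) (cong₂ _+_ (sumOver-*ˡ C 2 _) (sumOver-*ˡ C (2 + k′) _))

  count-edges : ∀ {p} (C : Subset (m G)) (f : Edge → ℕ) (g : Fin p → Edge) → Inj g → (∀ i → enc (g i) ∈ C) →
    ∑ (f ∘ g) ≤ sumOver C (f ∘ dec)
  count-edges C f g g-inj g∈ = subst (_≤ sumOver C (f ∘ dec)) (∑-cong (λ i → cong f (dec-enc (g i))))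
    (sumOver-injection C (f ∘ dec) (enc ∘ g) (g-inj ∘ enc-injective) g∈)

  size≡ : ∀ C → sumOver C (λ _ → 1) ≡ rings C + zigs C
  size≡ C = trans (sumOver-cong C (λ e → one (dec e))) (sumOver-+ C _ _)
    where
    one : ∀ x → 1 ≡ isRing x + isZig x
    one (ring _ _) = refl
    one (inj₂ _)   = refl

  decode : ∀ e → ∃ λ x → e ≡ enc x
  decode e = dec e , sym (enc-dec e)

  Incident⇒At : ∀ {x v} → Incident G (enc x) (encV v) → At x v
  Incident⇒At {x} (inj₁ p) = inj₁ (encV-injective (trans (sym (cong proj₁ (ends-enc x))) p))
  Incident⇒At {x} (inj₂ p) = inj₂ (encV-injective (trans (sym (cong proj₂ (ends-enc x))) p))

  At⇒Incident : ∀ {x v} → At x v → Incident G (enc x) (encV v)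
  At⇒Incident {x} (inj₁ p) = inj₁ (trans (cong proj₁ (ends-enc x)) (cong encV p))
  At⇒Incident {x} (inj₂ p) = inj₂ (trans (cong proj₂ (ends-enc x)) (cong encV p))

  module _ (C : Subset (m G)) (degrees : ∀ v → deg G C v ≡ 0 ⊎ deg G C v ≡ 2) where

    other : ∀ x {v} → enc x ∈ C → At x v → ∃ λ y → y ≢ x × enc y ∈ C × At y v
    other x {v} x∈ at with other-edge G C (encV v) (enc x) (degrees (encV v))
                           (λ eq → loopless x (encV-injective (trans (sym (cong proj₁ (ends-enc x)))
                             (trans eq (cong proj₂ (ends-enc x)))))) x∈ (At⇒Incident at)
    ... | e , ne , e∈ , inc with decode e
    ...   | y , refl = y , (ne ∘ cong enc) , e∈ , Incident⇒At inc

    -- Colour the rings alternately 0 and 1 and sum colour times degree over the vertices. The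
    -- degrees make the sum even; a ring edge contributes 0 or 2 to it and a zigzag edge contributes
    -- 1.
    zigs-even : ∃ λ q → zigs C ≡ 2 * q
    -- The subtraction is not truncated, since `balance` says that `2 * B` is `zigs C + 2 * A`.
    zigs-even = B ∸ A , (begin
      zigs C                   ≡⟨ sym (m+n∸n≡m (zigs C) (2 * A)) ⟩
      zigs C + 2 * A ∸ 2 * A   ≡⟨ cong (_∸ 2 * A) (sym balance) ⟩
      2 * B ∸ 2 * A            ≡⟨ sym (*-distribˡ-∸ 2 B A) ⟩
      2 * (B ∸ A)              ∎)
      where
      open ≡-Reasoning
      colour : V → ℕ
      colour (i , _) = parity (toℕ i)
      h : Fin (n G) → ℕ
      h v = colour (decV v)
      half : ∀ v → ∃ λ d → deg G C v ≡ 2 * d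
      half v with degrees v
      ... | inj₁ p = 0 , p
      ... | inj₂ p = 1 , p
      A = sumOver C (λ e → isRing (dec e) * colour (tailE (dec e)))
      B = ∑ (λ v → h v * proj₁ (half v))
      ends-colour : ∀ x → colour (tailE x) + colour (headE x) ≡ isZig x + 2 * (isRing x * colour (tailE x))
      ends-colour (ring i j) = double (parity (toℕ i))
        where
        double : ∀ p → p + p ≡ 2 * (1 * p)
        double = solve-∀
      ends-colour (inj₂ z) = trans (cong (λ x → parity x + parity (suc (toℕ (band z)))) (toℕ-inject₁ (band z)))
        (parity-step (toℕ (band z)))
      pull : ∀ a b c → b ≡ 2 * c → a * b ≡ 2 * (a * c)
      pull a b c refl = lemma a c
        where
        lemma : ∀ a c → a * (2 * c) ≡ 2 * (a * c)
        lemma = solve-∀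
      balance : 2 * B ≡ zigs C + 2 * A
      balance = begin
        2 * B
          ≡⟨ sym (∑-*ˡ 2 (λ v → h v * proj₁ (half v))) ⟩
        ∑ (λ v → 2 * (h v * proj₁ (half v)))
          ≡⟨ ∑-cong (λ v → sym (pull (h v) _ _ (proj₂ (half v)))) ⟩
        ∑ (λ v → h v * deg G C v)
          ≡⟨ handshake G C h ⟩
        sumOver C (λ e → h (tail G e) + h (head G e))
          ≡⟨ sumOver-cong C (λ e → trans (cong₂ (λ u w → colour u + colour w)
               (decV-encV (tailE (dec e))) (decV-encV (headE (dec e)))) (ends-colour (dec e))) ⟩
        sumOver C (λ e → isZig (dec e) + 2 * (isRing (dec e) * colour (tailE (dec e))))
          ≡⟨ sumOver-+ C _ _ ⟩
        zigs C + sumOver C (λ e → 2 * (isRing (dec e) * colour (tailE (dec e))))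
          ≡⟨ cong (zigs C +_) (sumOver-*ˡ C 2 _) ⟩
        zigs C + 2 * A
          ∎

    -- The edges listed by `g` already use up the whole sum of `f` over `C`, while any further edge
    -- of `C` would add at least 1.
    covered : ∀ {p} (f : Edge → ℕ) (g : Fin p → Edge) → Inj g → (∀ i → enc (g i) ∈ C) →
      (∀ x → enc x ∈ C → 1 ≤ f x) → sumOver C (f ∘ dec) ≤ ∑ (f ∘ g) → C ≡ image (enc ∘ g)
    covered f g g-inj g∈ f≥1 le = ⊆-antisym C⊆ ⊆C
      where
      C⊆ : ∀ {e} → e ∈ C → e ∈ image (enc ∘ g)
      C⊆ {e} e∈ with any? (λ i → enc (g i) ≟ e)
      ... | yes (i , refl) = ∈-image⁺ (enc ∘ g) i
      ... | no none with dec e | enc-dec e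
      ...   | x | refl = contradiction
        (≤-trans (+-monoˡ-≤ _ (f≥1 x e∈)) (≤-trans
          (count-edges C f (extend x g) (extend-injective (λ i eq → none (i , cong enc eq)) g-inj)
             (λ { zero → e∈ ; (suc i) → g∈ i })) le)) (<⇒≱ ≤-refl)
      ⊆C : ∀ {e} → e ∈ image (enc ∘ g) → e ∈ C
      ⊆C {e} e∈ with ∈-image⁻ (enc ∘ g) e e∈
      ... | i , refl = g∈ i

    -- Apart from zigzag edges, a vertex meets just two edges, the two neighbouring edges of its
    -- ring; so degree two carries membership from one to the other.
    ring-closed : (∀ z → enc (inj₂ z) ∉ C) → ∀ i j → enc (ring i j) ∈ C → enc (ring i (next j)) ∈ C
    ring-closed no-zig i j j∈ with other (ring i j) {i , next j} j∈ (inj₂ refl)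
    ... | inj₂ z , _ , z∈ , _ = contradiction z∈ (no-zig z)
    ... | ring _ _ , _ , y∈ , inj₁ refl = y∈
    ... | ring i′ j′ , ne , y∈ , inj₂ eq =
      contradiction (cong₂ (λ a b → ring a b) (cong proj₁ eq) (next-injective (cong proj₂ eq))) ne

    ring-closed′ : (∀ z → enc (inj₂ z) ∉ C) → ∀ i j → enc (ring i (next j)) ∈ C → enc (ring i j) ∈ C
    ring-closed′ no-zig i j j∈ with other (ring i (next j)) {i , next j} j∈ (inj₁ refl)
    ... | inj₂ z , _ , z∈ , _ = contradiction z∈ (no-zig z)
    ... | ring _ _ , ne , y∈ , inj₁ refl = contradiction refl ne
    ... | ring i′ j′ , ne , y∈ , inj₂ eq =
      subst (λ x → enc x ∈ C) (cong₂ (λ a b → ring a b) (cong proj₁ eq) (next-injective (cong proj₂ eq))) y∈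

    whole-ring : (∀ z → enc (inj₂ z) ∉ C) → ∀ i j → enc (ring i j) ∈ C → ∀ j′ → enc (ring i j′) ∈ C
    whole-ring no-zig i j j∈ = up
      where
      -- Membership first travels back to column zero and from there to every column.
      down : ∀ j → enc (ring i j) ∈ C → enc (ring i zero) ∈ C
      down = <-weakInduction _ id (λ x ih x∈ → ih (ring-closed′ no-zig i (inject₁ x)
               (subst (λ y → enc (ring i y) ∈ C) (sym (next-inject₁ x)) x∈)))
      up : ∀ j → enc (ring i j) ∈ C
      up = <-weakInduction _ (down j j∈) (λ x ih → subst (λ y → enc (ring i y) ∈ C) (next-inject₁ x)
               (ring-closed no-zig i (inject₁ x) ih))

    IsShape : Set
    IsShape = ∃ λ x → C ≡ sides x

    -- The edges of one whole ring already weigh `2 * k`; equality leaves no room for another edge.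
    weight-no-zig : (∃ λ e → e ∈ C) → (∀ z → enc (inj₂ z) ∉ C) → 2 * k ≤ weight C × (weight C ≡ 2 * k → IsShape)
    weight-no-zig (e , e∈) no-zig with dec e | enc-dec e
    ... | inj₂ z   | refl = contradiction e∈ (no-zig z)
    ... | ring i j | refl = bound , shape
      where
      all∈ : ∀ j → enc (ring i j) ∈ C
      all∈ = whole-ring no-zig i j e∈
      k≡ : k ≡ ∑ (λ (j : Fin k) → isRing (ring i j))
      k≡ = sym (trans (∑-const {k} 1) (*-identityʳ k))
      k≤ : k ≤ rings C
      k≤ = subst (_≤ rings C) (sym k≡) (count-edges C isRing (λ j → ring i j) (λ { refl → refl }) all∈)
      2r≤ : 2 * rings C ≤ weight C
      2r≤ = subst (2 * rings C ≤_) (sym (weight≡ C)) (m≤m+n _ _)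
      bound : 2 * k ≤ weight C
      bound = ≤-trans (*-monoʳ-≤ 2 k≤) 2r≤
      is-ring : ∀ x → enc x ∈ C → 1 ≤ isRing x
      is-ring (ring _ _) _ = s≤s z≤n
      is-ring (inj₂ z) z∈  = contradiction z∈ (no-zig z)
      shape : weight C ≡ 2 * k → IsShape
      shape eq = R i , covered isRing (λ j → ring i j) (λ { refl → refl }) all∈ is-ring
        (subst (rings C ≤_) k≡ (*-cancelˡ-≤ 2 (subst (2 * rings C ≤_) eq 2r≤)))

    -- `C` continues at both ends of the zigzag edge, and by `zig-simple` the two continuing edges
    -- are distinct.
    3≤size : ∀ z → enc (inj₂ z) ∈ C → 3 ≤ rings C + zigs C
    3≤size z z∈ with other (inj₂ z) z∈ (inj₁ refl) | other (inj₂ z) z∈ (inj₂ refl)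
    ... | x , x≢ , x∈ , xat | y , y≢ , y∈ , yat = subst (3 ≤_) (size≡ C)
      (count-edges C (λ _ → 1) (three (inj₂ z) x y)
        (three-injective (x≢ ∘ sym) (y≢ ∘ sym) (λ { refl → x≢ (zig-simple z x xat yat) }))
        (λ { zero → z∈ ; (suc zero) → x∈ ; (suc (suc zero)) → y∈ }))

    two-edges : ∀ (f : Edge → ℕ) x y → x ≢ y → enc x ∈ C → enc y ∈ C → f x + (f y + 0) ≤ sumOver C (f ∘ dec)
    two-edges f x y ne x∈ y∈ = count-edges C f g g-inj (λ { zero → x∈ ; (suc zero) → y∈ })
      where
      g : Fin 2 → Edge
      g = extend x (λ _ → y)
      g-inj : Inj g
      g-inj = extend-injective (λ _ → ne ∘ sym) (λ { {zero} {zero} _ → refl })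

    -- The only ring edge is continued at both ends by zigzag edges, and these must close up with
    -- each other because `C` has no fourth edge.
    light-triangle : rings C ≡ 1 → zigs C ≡ 2 → IsShape
    light-triangle r≡1 z≡2 with sumOver-positive C (isRing ∘ dec) (subst (0 <_) (sym r≡1) (s≤s z≤n))
    ... | e , e∈ , nz with dec e | enc-dec e
    ...   | inj₂ z   | _ = contradiction refl nz
    ...   | ring i j | refl = finish (other (ring i j) e∈ (inj₁ refl)) (other (ring i j) e∈ (inj₂ refl))
      where
      finish : (∃ λ y → y ≢ ring i j × enc y ∈ C × At y (i , j)) →
               (∃ λ y → y ≢ ring i j × enc y ∈ C × At y (i , next j)) → IsShape
      finish (ring _ _ , ne , y∈ , _) _ = contradiction (subst (2 ≤_) r≡1 (two-edges isRing _ _ ne y∈ e∈)) (<⇒≱ ≤-refl)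
      finish _ (ring _ _ , ne , y∈ , _) = contradiction (subst (2 ≤_) r≡1 (two-edges isRing _ _ ne y∈ e∈)) (<⇒≱ ≤-refl)
      finish (inj₂ y , _ , y∈ , yat) (inj₂ z , _ , z∈ , zat) = meet (opposite yat)
        where
        y≢z : inj₂ y ≢ inj₂ z
        y≢z refl = next-irrefl j (sym (cong proj₂ (zig-row y yat zat refl)))
        tri : Edge → Edge → Edge → Subset (m G)
        tri a b c = image (enc ∘ three a b c)
        exact : ∀ {a b c} → a ≢ b → a ≢ c → b ≢ c → enc a ∈ C → enc b ∈ C → enc c ∈ C → C ≡ tri a b c
        exact ab ac bc a∈ b∈ c∈ = covered (λ _ → 1) (three _ _ _) (three-injective ab ac bc)
          (λ { zero → a∈ ; (suc zero) → b∈ ; (suc (suc zero)) → c∈ }) (λ _ _ → ≤-refl)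
          (≤-reflexive (trans (size≡ C) (cong₂ _+_ r≡1 z≡2)))
        opposite : At (inj₂ y) (i , j) → ∃ λ v → At (inj₂ y) v × proj₁ v ≢ i
        opposite (inj₁ refl) = _ , inj₂ refl , inject₁≢suc (band y) ∘ sym
        opposite (inj₂ refl) = _ , inj₁ refl , inject₁≢suc (band y)
        -- The edge continuing `y` at its far end `v` is one of the three edges of `C`. It is not
        -- the ring edge, as `v` lies off ring `i`, and not `y` itself, so it is `z`.
        meet : (∃ λ v → At (inj₂ y) v × proj₁ v ≢ i) → IsShape
        meet (v , vat , v≢i) with other (inj₂ y) y∈ vat
        ... | x , x≢y , x∈ , xat with ∈-image⁻ (enc ∘ three (ring i j) (inj₂ y) (inj₂ z)) (enc x)
                (subst (enc x ∈_) (exact (λ ()) (λ ()) y≢z e∈ y∈ z∈) x∈)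
        ... | zero , eq = contradiction (sym (ring-row (subst (λ q → At q v) (sym (enc-injective eq)) xat))) v≢i
        ... | suc zero , eq = contradiction (sym (enc-injective eq)) x≢y
        ... | suc (suc zero) , eq with triangle i j y z yat zat vat (subst (λ q → At q v) (sym (enc-injective eq)) xat) v≢i
        ...   | inj₁ (b , refl , refl , refl) = U b j , exact (λ ()) (λ ()) (λ ()) e∈ z∈ y∈
        ...   | inj₂ (b , refl , refl , refl) = D b j , exact (λ ()) (λ ()) (λ ()) e∈ z∈ y∈

    weight-zig : ∀ z → enc (inj₂ z) ∈ C → 2 * k ≤ weight C × (weight C ≡ 2 * k → IsShape)
    weight-zig z z∈ with zigs-even
    ... | zero , eq = contradiction (subst (1 ≤_) eq
      (count-edges {1} C isZig (λ _ → inj₂ z) (λ { {zero} {zero} _ → refl }) (λ _ → z∈))) (λ ())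
    -- Two zigzag edges weigh `2 * (k - 1)`, and the third edge that exists by `3≤size` must be a
    -- ring edge, of weight 2. Equality therefore means exactly one ring edge.
    ... | suc zero , eq =
        subst (2 * k ≤_) (sym w) (≤-trans (≤-reflexive (arith k′)) (+-monoˡ-≤ _ (*-monoʳ-≤ 2 1≤r))) ,
        (λ weq → light-triangle (*-cancelˡ-≡ _ _ 2
                   (+-cancelʳ-≡ ((2 + k′) * 2) _ _ (trans (sym w) (trans weq (arith k′))))) eq)
      where
      w : weight C ≡ 2 * rings C + (2 + k′) * 2
      w = trans (weight≡ C) (cong (λ x → 2 * rings C + (2 + k′) * x) eq)
      1≤r : 1 ≤ rings C
      1≤r = +-cancelʳ-≤ 2 1 (rings C) (subst (λ x → 3 ≤ rings C + x) eq (3≤size z z∈))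
      arith : ∀ x → 2 * (3 + x) ≡ 2 * 1 + (2 + x) * 2
      arith = solve-∀
    -- Four zigzag edges weigh `4 * (k - 1)`, which exceeds `2 * k` by `2 + 2 * k′`.
    ... | suc (suc q) , eq = <⇒≤ heavy , (λ weq → contradiction weq (<⇒≢ heavy ∘ sym))
      where
      arith : ∀ x → 2 * (3 + x) + (2 + 2 * x) ≡ (2 + x) * 4
      arith = solve-∀
      4≤z : 4 ≤ zigs C
      4≤z = subst (4 ≤_) (sym eq) (*-monoʳ-≤ 2 (s≤s (s≤s z≤n)))
      heavy : 2 * k < weight C
      heavy = ≤-trans (≤-trans (≤-trans (m<m+n (2 * k) (s≤s z≤n)) (≤-reflexive (arith k′))) (*-monoʳ-≤ (2 + k′) 4≤z))
        (subst ((2 + k′) * zigs C ≤_) (sym (weight≡ C)) (m≤n+m _ (2 * rings C)))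

  cycle-weight : ∀ C → IsCycle G C → 2 * k ≤ weight C × (weight C ≡ 2 * k → ∃ λ x → C ≡ sides x)
  cycle-weight C (nonempty , degrees , _) with any? (λ e → (e ∈? C) ×-dec ¬? (isZig (dec e) ℕ.≟ 0))
  ... | no none = weight-no-zig C degrees nonempty (λ z z∈ → none (enc (inj₂ z) , z∈ ,
        λ eq → contradiction (trans (cong isZig (sym (dec-enc (inj₂ z)))) eq) (λ ())))
  ... | yes (e , e∈ , nz) with dec e | enc-dec e
  ...   | ring _ _ | _ = contradiction refl nz
  ...   | inj₂ z   | refl = weight-zig C degrees z e∈

  -- This puts the average weight of the members of a double cover of size `2 * k * L + 2` at the
  -- minimum `2 * k`, with no slack.
  total-weight : 2 * ∑ (λ e → 2 * isRing (dec e) + (2 + k′) * isZig (dec e)) ≡ (2 * k * L + 2) * (2 * k)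
  total-weight = trans (cong (2 *_) (trans (∑-cell vertex (λ x → 2 * isRing x + (2 + k′) * isZig x))
      (cong₂ _+_ (trans (∑-const {#V} _) (cong (_* (2 + (2 + k′) * 0)) #V≡))
                 (cong₂ _+_ (∑-const {L * k} ((2 + k′) * 1)) (∑-const {L * k} ((2 + k′) * 1))))))
    (arith L k′)
    where
    arith : ∀ l x → 2 * ((suc l * (3 + x)) * (2 + (2 + x) * 0) +
                         (l * (3 + x) * ((2 + x) * 1) + l * (3 + x) * ((2 + x) * 1)))
                    ≡ (2 * (3 + x) * l + 2) * (2 * (3 + x))
    arith = solve-∀

  -- Double covers

  faces : ℕ
  faces = 2 * k * L + 2

  _≟ˢ_ : DecidableEquality (Subset (m G))
  _≟ˢ_ = ≡-dec Bool._≟_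

  open Count _≟ˢ_

  Shapes : List (Subset (m G)) → Set
  Shapes = All (λ C → ∃ λ x → C ≡ sides x)

  -- Every edge is counted twice, so the weights of the members add up to `faces` times the least
  -- possible weight; hence every member attains it.
  CDC⇒Shapes : ∀ Cs → IsCDC G faces Cs → Shapes Cs
  CDC⇒Shapes Cs (cycles , covers , len) = All.map light⇒shape (All.zip (cycles , tight))
    where
    w : Fin (m G) → ℕ
    w e = 2 * isRing (dec e) + (2 + k′) * isZig (dec e)
    total : sumL weight Cs ≡ length Cs * (2 * k)
    total = begin
      sumL weight Cs                                ≡⟨ sumL-∑ (λ C e → χ C e * w e) Cs ⟩
      ∑ (λ e → sumL (λ C → χ C e * w e) Cs)         ≡⟨ ∑-cong (λ e → sumL-*ʳ (w e) (λ C → χ C e) Cs) ⟩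
      ∑ (λ e → sumL (λ C → χ C e) Cs * w e)         ≡⟨ ∑-cong (λ e → cong (_* w e)
                                                         (trans (sym (cover≡sumL G e Cs)) (covers e))) ⟩
      ∑ (λ e → 2 * w e)                             ≡⟨ ∑-*ˡ 2 w ⟩
      2 * ∑ w                                       ≡⟨ total-weight ⟩
      faces * (2 * k)                               ≡⟨ cong (_* (2 * k)) (sym len) ⟩
      length Cs * (2 * k)                           ∎
      where open ≡-Reasoning
    tight : All (λ C → weight C ≡ 2 * k) Cs
    tight = sumL-tight weight (2 * k) Cs (All.map (λ {C} c → proj₁ (cycle-weight C c)) cycles) (≤-reflexive total)
    light⇒shape : ∀ {C} → IsCycle G C × weight C ≡ 2 * k → ∃ λ x → C ≡ sides x
    light⇒shape {C} (c , eq) = proj₂ (cycle-weight C c) eq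

  -- The shapes that contain a given edge.

  s-owner : ∀ {b j} x → enc (s b j) ∈ sides x → x ≡ U b j ⊎ (∃ λ j′ → next j′ ≡ j × x ≡ D b j′)
  s-owner {b} {j} x x∈ with x | ∈sides x (s b j) x∈
  ... | R i     | _ , ()
  ... | U _ _   | suc (suc zero) , refl = inj₁ refl
  ... | D _ j′  | suc zero , refl = inj₂ (j′ , refl , refl)
  ... | D _ _   | suc (suc zero) , ()

  t-owner : ∀ {b j} x → enc (t b j) ∈ sides x → x ≡ U b j ⊎ x ≡ D b j
  t-owner {b} {j} x x∈ with x | ∈sides x (t b j) x∈
  ... | R i     | _ , ()
  ... | U _ _   | suc zero , refl = inj₁ refl
  ... | U _ _   | suc (suc zero) , ()
  ... | D _ _   | suc (suc zero) , refl = inj₂ refl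

  ring-owner : ∀ {i j} x → enc (ring i j) ∈ sides x →
    x ≡ R i ⊎ (∃ λ b → inject₁ b ≡ i × x ≡ U b j) ⊎ (∃ λ b → suc b ≡ i × x ≡ D b j)
  ring-owner {i} {j} x x∈ with x | ∈sides x (ring i j) x∈
  ... | R _   | _ , refl = inj₁ refl
  ... | U b _ | zero , refl = inj₂ (inj₁ (b , refl , refl))
  ... | U _ _ | suc (suc zero) , ()
  ... | D b _ | zero , refl = inj₂ (inj₂ (b , refl , refl))
  ... | D _ _ | suc (suc zero) , ()

  -- A triangle is recovered from its two zigzag edges, because the other triangles on them are
  -- different. A ring is recovered from two of its edges, because a triangle has only one ring
  -- edge.
  sides-injective : Inj sides
  sides-injective {U b j} {y} eq
    with t-owner {b} {j} y (subst (enc (t b j) ∈_) eq (side∈ (U b j) (suc zero)))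
       | s-owner {b} {j} y (subst (enc (s b j) ∈_) eq (side∈ (U b j) (suc (suc zero))))
  ... | inj₁ refl | _ = refl
  ... | inj₂ refl | inj₂ (j′ , next≡ , refl) = contradiction next≡ (next-irrefl j)
  sides-injective {D b j} {y} eq
    with t-owner {b} {j} y (subst (enc (t b j) ∈_) eq (side∈ (D b j) (suc (suc zero))))
       | s-owner {b} {next j} y (subst (enc (s b (next j)) ∈_) eq (side∈ (D b j) (suc zero)))
  ... | inj₂ refl | _ = refl
  ... | inj₁ refl | inj₁ p = contradiction (sym (same p)) (next-irrefl j)
    where
    same : ∀ {b b′ j j′} → _≡_ {A = Shape} (U b j) (U b′ j′) → j ≡ j′
    same refl = refl
  sides-injective {R i} {y} eq
    with ring-owner {i} {zero} y (subst (enc (ring i zero) ∈_) eq (side∈ (R i) zero))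
       | ring-owner {i} {suc zero} y (subst (enc (ring i (suc zero)) ∈_) eq (side∈ (R i) (suc zero)))
  ... | inj₁ refl | _ = refl
  ... | inj₂ _    | inj₁ refl = refl
  ... | inj₂ (inj₁ (_ , _ , refl)) | inj₂ (inj₁ (_ , _ , ()))
  ... | inj₂ (inj₁ (_ , _ , refl)) | inj₂ (inj₂ (_ , _ , ()))
  ... | inj₂ (inj₂ (_ , _ , refl)) | inj₂ (inj₁ (_ , _ , ()))
  ... | inj₂ (inj₂ (_ , _ , refl)) | inj₂ (inj₂ (_ , _ , ()))

  -- As `sides` is injective, a member of `Cs` that contains `enc e` equals `sides (o i)` for
  -- exactly one `i`.
  cover-owners : ∀ {p} e (o : Fin p → Shape) → Inj o → (∀ i → enc e ∈ sides (o i)) →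
    (∀ x → enc e ∈ sides x → ∃ λ i → o i ≡ x) →
    ∀ {Cs} → Shapes Cs → cover G (enc e) Cs ≡ ∑ (λ i → count (sides (o i)) Cs)
  cover-owners {p} e o o-inj e∈ owner {Cs} shapes =
    trans (cover≡sumL G (enc e) Cs)
    (trans (sumL-cong shapes pointwise) (sumL-∑ (λ C i → ⟦ C ≟ˢ sides (o i) ⟧) Cs))
    where
    pointwise : ∀ C → (∃ λ x → C ≡ sides x) → χ C (enc e) ≡ ∑ (λ i → ⟦ C ≟ˢ sides (o i) ⟧)
    pointwise C (x , refl) with enc e ∈? sides x
    ... | no e∉ = sym (trans (∑-cong (λ i → ⟦no⟧ (sides x ≟ˢ sides (o i))
                                 (λ eq → e∉ (subst (enc e ∈_) (sym eq) (e∈ i))))) (∑-zero {p}))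
    ... | yes x∈ with owner x x∈
    ...   | i , refl = sym (trans
      (∑-supported-at _ i (λ j ne → ⟦no⟧ (sides (o i) ≟ˢ sides (o j)) (ne ∘ sym ∘ o-inj ∘ sides-injective)))
      (⟦yes⟧ (sides (o i) ≟ˢ sides (o i)) refl))

  -- The double cover condition, edge by edge, in terms of the multiplicities of the shapes. The
  -- value 0 supplied by `after` and by `before 0` stands for the triangles missing above the top
  -- ring and below the bottom ring.
  record Balanced (μ : Shape → ℕ) : Set where
    field
      at-s    : ∀ b j → μ (U b (next j)) + μ (D b j) ≡ 2
      at-t    : ∀ b j → μ (U b j) + μ (D b j) ≡ 2
      at-ring : ∀ i j → μ (R i) + (after (λ b → μ (U b j)) i + before 0 (λ b → μ (D b j)) i) ≡ 2
  open Balanced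

  Balanced-cong : ∀ {μ ν} → (∀ x → μ x ≡ ν x) → Balanced μ → Balanced ν
  Balanced-cong h bal .at-s b j = trans (sym (cong₂ _+_ (h (U b (next j))) (h (D b j)))) (at-s bal b j)
  Balanced-cong h bal .at-t b j = trans (sym (cong₂ _+_ (h (U b j)) (h (D b j)))) (at-t bal b j)
  Balanced-cong h bal .at-ring i j = trans (sym (cong₂ _+_ (h (R i))
    (cong₂ _+_ (after-cong (λ b → h (U b j)) i) (before-cong 0 (λ b → h (D b j)) i)))) (at-ring bal i j)

  module _ {Cs} (shapes : Shapes Cs) where

    private
      # : Shape → ℕ
      # x = count (sides x) Cs

    cover-s : ∀ b j → cover G (enc (s b (next j))) Cs ≡ # (U b (next j)) + # (D b j)
    cover-s b j = trans (cover-owners (s b (next j)) (pair (U b (next j)) (D b j)) (pair-injective (λ ()))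
        (λ { zero → side∈ (U b (next j)) (suc (suc zero)) ; (suc zero) → side∈ (D b j) (suc zero) }) owner shapes)
      (cong (# (U b (next j)) +_) (+-identityʳ _))
      where
      owner : ∀ x → enc (s b (next j)) ∈ sides x → ∃ λ i → pair (U b (next j)) (D b j) i ≡ x
      owner x x∈ with s-owner x x∈
      ... | inj₁ eq = zero , sym eq
      ... | inj₂ (j′ , p , eq) = suc zero , trans (cong (λ q → D b q) (sym (next-injective p))) (sym eq)

    cover-t : ∀ b j → cover G (enc (t b j)) Cs ≡ # (U b j) + # (D b j)
    cover-t b j = trans (cover-owners (t b j) (pair (U b j) (D b j)) (pair-injective (λ ()))
        (λ { zero → side∈ (U b j) (suc zero) ; (suc zero) → side∈ (D b j) (suc (suc zero)) }) owner shapes)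
      (cong (# (U b j) +_) (+-identityʳ _))
      where
      owner : ∀ x → enc (t b j) ∈ sides x → ∃ λ i → pair (U b j) (D b j) i ≡ x
      owner x x∈ with t-owner x x∈
      ... | inj₁ eq = zero , sym eq
      ... | inj₂ eq = suc zero , sym eq

    cover-ring : ∀ i j → cover G (enc (ring i j)) Cs ≡
      # (R i) + (after (λ b → # (U b j)) i + before 0 (λ b → # (D b j)) i)
    cover-ring zero j = cover-owners (ring zero j) (pair (R zero) (U zero j)) (pair-injective (λ ()))
        (λ { zero → side∈ (R zero) j ; (suc zero) → side∈ (U zero j) zero }) owner shapes
      where
      owner : ∀ x → enc (ring zero j) ∈ sides x → ∃ λ i → pair (R zero) (U zero j) i ≡ x
      owner x x∈ with ring-owner x x∈
      ... | inj₁ eq = zero , sym eq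
      ... | inj₂ (inj₁ (zero , p , eq)) = suc zero , sym eq
    -- An edge of the top ring lies on that ring and one triangle below it; an edge of a middle ring
    -- also has a triangle above it.
    cover-ring (suc b) j with view b
    ... | ‵fromℕ = trans (cover-owners (ring (fromℕ L) j) (pair (R (fromℕ L)) (D (fromℕ L′) j)) (pair-injective (λ ()))
        (λ { zero → side∈ (R (fromℕ L)) j ; (suc zero) → side∈ (D (fromℕ L′) j) zero }) owner shapes)
        (cong (# (R (fromℕ L)) +_) (trans (+-identityʳ _)
          (cong (_+ # (D (fromℕ L′) j)) (sym (after-fromℕ (λ b → # (U b j)))))))
      where
      owner : ∀ x → enc (ring (fromℕ L) j) ∈ sides x → ∃ λ i → pair (R (fromℕ L)) (D (fromℕ L′) j) i ≡ x
      owner x x∈ with ring-owner x x∈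
      ... | inj₁ eq = zero , sym eq
      ... | inj₂ (inj₁ (b , p , eq)) = contradiction (sym p) fromℕ≢inject₁
      ... | inj₂ (inj₂ (b , refl , eq)) = suc zero , sym eq
    ... | ‵inject₁ c = trans (cover-owners (ring i j) o (three-injective (λ ()) (λ ()) (λ ()))
        (λ { zero → side∈ (R i) j ; (suc zero) → side∈ (U (suc c) j) zero
           ; (suc (suc zero)) → side∈ (D (inject₁ c) j) zero }) owner shapes)
        (cong (# (R i) +_) (cong₂ _+_ (sym (after-inject₁ (λ b → # (U b j)) (suc c))) (+-identityʳ _)))
      where
      i : Fin ℓ
      i = suc (inject₁ c)
      o : Fin 3 → Shape
      o = three (R i) (U (suc c) j) (D (inject₁ c) j)
      owner : ∀ x → enc (ring i j) ∈ sides x → ∃ λ i → o i ≡ x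
      owner x x∈ with ring-owner x x∈
      ... | inj₁ eq = zero , sym eq
      ... | inj₂ (inj₁ (b , p , eq)) = suc zero , trans (cong (λ q → U q j) (sym (inject₁-injective p))) (sym eq)
      ... | inj₂ (inj₂ (b , refl , eq)) = suc (suc zero) , sym eq

    covers⇒Balanced : (∀ e → cover G e Cs ≡ 2) → Balanced #
    covers⇒Balanced h .at-s b j    = trans (sym (cover-s b j)) (h _)
    covers⇒Balanced h .at-t b j    = trans (sym (cover-t b j)) (h _)
    covers⇒Balanced h .at-ring i j = trans (sym (cover-ring i j)) (h _)

    Balanced⇒covers : Balanced # → ∀ e → cover G e Cs ≡ 2
    Balanced⇒covers bal e = subst (λ e → cover G e Cs ≡ 2) (enc-dec e) (edgewise (dec e))
      where
      edgewise : ∀ x → cover G (enc x) Cs ≡ 2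
      edgewise (ring i j) = trans (cover-ring i j) (at-ring bal i j)
      edgewise (s b j)    = subst (λ q → cover G (enc (s b q)) Cs ≡ 2) (next-prev j)
                              (trans (cover-s b (prev j)) (at-s bal b (prev j)))
      edgewise (t b j)    = trans (cover-t b j) (at-t bal b j)

  -- From balanced multiplicities to descending sequences and back.

  mult : (Fin L → ℕ) → Shape → ℕ
  mult a (R i)   = before 2 a i ∸ after a i
  mult a (U b j) = a b
  mult a (D b j) = 2 ∸ a b

  mult-cong : ∀ {a a′} → (∀ b → a b ≡ a′ b) → ∀ x → mult a x ≡ mult a′ x
  mult-cong h (R i)   = cong₂ _∸_ (before-cong 2 h i) (after-cong h i)
  mult-cong h (U b j) = h b
  mult-cong h (D b j) = cong (2 ∸_) (h b)

  module _ {μ : Shape → ℕ} (bal : Balanced μ) where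

    ups : Fin L → ℕ
    ups b = μ (U b zero)

    -- The edges `s b (next j)` and `t b j` share the triangle `D b j`, so the other triangles on
    -- them, `U b (next j)` and `U b j`, have equal multiplicities.
    U≡ups : ∀ b j → μ (U b j) ≡ ups b
    U≡ups b = next-stable (λ j → μ (U b j))
      (λ j → +-cancelʳ-≡ (μ (D b j)) _ _ (trans (at-s bal b j) (sym (at-t bal b j))))

    D≡ : ∀ b j → μ (D b j) ≡ 2 ∸ ups b
    D≡ b j = trans (sym (m+n∸m≡n (μ (U b j)) (μ (D b j)))) (cong₂ _∸_ (at-t bal b j) (U≡ups b j))

    ups≤2 : ∀ b → ups b ≤ 2
    ups≤2 b = subst (ups b ≤_) (at-t bal b zero) (m≤m+n _ _)

    -- The downward triangles below ring `suc b` have multiplicity `2 ∸ ups b`, so the condition at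
    -- the ring edge says that the ring makes up for the drop from `ups b`. The bottom ring has no
    -- triangles below it, which corresponds to a preceding value 2.
    ring-step : ∀ i → μ (R i) + after ups i ≡ before 2 ups i
    ring-step zero = trans (cong (μ (R zero) +_) (sym (+-identityʳ _))) (at-ring bal zero zero)
    ring-step (suc b) = +-cancelʳ-≡ (2 ∸ ups b) _ _ (trans (+-assoc (μ (R (suc b))) _ _)
      (trans (cong (λ q → μ (R (suc b)) + (after ups (suc b) + q)) (sym (D≡ b zero)))
      (trans (at-ring bal (suc b) zero) (sym (m+[n∸m]≡n (ups≤2 b))))))

    ups-Descending : Descending 2 ups
    ups-Descending i = subst (after ups i ≤_) (ring-step i) (m≤n+m _ _)

    Balanced⇒mult : ∀ x → μ x ≡ mult ups x
    Balanced⇒mult (R i)   = trans (sym (m+n∸n≡m (μ (R i)) (after ups i))) (cong (_∸ after ups i) (ring-step i))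
    Balanced⇒mult (U b j) = U≡ups b j
    Balanced⇒mult (D b j) = D≡ b j

  shape : Shape ↔ Fin (cells ℓ)
  shape = cell ↔-refl

  decS : Fin (cells ℓ) → Shape
  decS = Inverse.from shape

  module _ (a : Fin L → ℕ) (desc : Descending 2 a) where

    up+down : ∀ b → a b + (2 ∸ a b) ≡ 2
    up+down b = m+[n∸m]≡n (Descending⇒≤ 2 a desc b)

    mult-Balanced : Balanced (mult a)
    mult-Balanced .at-s b j = up+down b
    mult-Balanced .at-t b j = up+down b
    mult-Balanced .at-ring i j = trans (sym (+-assoc (mult a (R i)) _ _))
      (trans (cong (_+ before 0 (λ b → 2 ∸ a b) i) (m∸n+n≡m (desc i))) (total i))
      where
      total : ∀ i → before 2 a i + before 0 (λ b → 2 ∸ a b) i ≡ 2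
      total zero    = refl
      total (suc b) = up+down b

    canonical : List (Subset (m G))
    canonical = fromMultiplicities (sides ∘ decS) (mult a ∘ decS)

    canonical-Shapes : Shapes canonical
    canonical-Shapes = All-fromMultiplicities (sides ∘ decS) (mult a ∘ decS) (λ i → decS i , refl)

    canonical-count : ∀ x → count (sides x) canonical ≡ mult a x
    canonical-count x = trans (sumL-fromMultiplicities (λ C → ⟦ C ≟ˢ sides x ⟧) (sides ∘ decS) (mult a ∘ decS))
      (trans (∑-supported-at _ i off)
      (trans (cong₂ _*_ (cong (mult a) decS-i) (⟦yes⟧ (sides (decS i) ≟ˢ sides x) (cong sides decS-i)))
             (*-identityʳ (mult a x))))
      where
      i : Fin (cells ℓ)
      i = Inverse.to shape x
      decS-i : decS i ≡ x
      decS-i = Inverse.strictlyInverseʳ shape x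
      off : ∀ j → j ≢ i → mult a (decS j) * ⟦ sides (decS j) ≟ˢ sides x ⟧ ≡ 0
      off j ne = trans (cong (mult a (decS j) *_) (⟦no⟧ (sides (decS j) ≟ˢ sides x)
        (λ eq → ne (trans (sym (Inverse.strictlyInverseˡ shape j)) (cong (Inverse.to shape) (sides-injective eq))))))
        (*-zeroʳ (mult a (decS j)))

    -- The multiplicities of the rings are the drops and add up to 2, and each of the `L * k` pairs
    -- `U b j`, `D b j` contributes 2.
    canonical-length : length canonical ≡ faces
    canonical-length = trans (length-fromMultiplicities (sides ∘ decS) (mult a ∘ decS))
      (trans (∑-cell ↔-refl (mult a))
      (trans (cong₂ _+_ (∑-drops 2 a desc)
        (trans (sym (∑-+ {L * k} (λ y → a (proj₁ (remQuot {L} k y))) (λ y → 2 ∸ a (proj₁ (remQuot {L} k y)))))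
        (trans (∑-cong {L * k} (λ y → up+down (proj₁ (remQuot {L} k y)))) (∑-const {L * k} 2))))
        (arith L k)))
      where
      arith : ∀ l q → 2 + l * q * 2 ≡ 2 * q * l + 2
      arith = solve-∀

    canonical-IsCDC : IsCDC G faces canonical
    canonical-IsCDC = All.map (λ { (x , refl) → sides-IsCycle x }) canonical-Shapes ,
      Balanced⇒covers canonical-Shapes (Balanced-cong (sym ∘ canonical-count) mult-Balanced) ,
      canonical-length

  -- Counting double covers by their profiles.

  profile : CDC G faces → Fin L → ℕ
  profile (Cs , _) b = count (sides (U b zero)) Cs

  balanced : ∀ (x : CDC G faces) → Balanced (λ y → count (sides y) (proj₁ x))
  balanced (Cs , cdc) = covers⇒Balanced (CDC⇒Shapes Cs cdc) (proj₁ (proj₂ cdc))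

  profile-canonical : ∀ a desc b → profile (canonical a desc , canonical-IsCDC a desc) b ≡ a b
  profile-canonical a desc b = canonical-count a desc (U b zero)

  -- A subset that is not a shape occurs in neither list.
  same-shape-counts⇒↭ : ∀ {Cs Ds} → Shapes Cs → Shapes Ds → (∀ x → count (sides x) Cs ≡ count (sides x) Ds) → Cs ↭ Ds
  same-shape-counts⇒↭ {Cs} {Ds} shC shD h = count⇒↭ Cs Ds same
    where
    same : ∀ C → count C Cs ≡ count C Ds
    same C with count C Cs in c | count C Ds in d
    ... | zero | zero = refl
    ... | suc _ | _ with All.lookup shC (0<count⇒∈ C Cs (subst (0 <_) (sym c) (s≤s z≤n)))
    ...   | x , refl = trans (sym c) (trans (h x) d)
    same C | zero | suc _ with All.lookup shD (0<count⇒∈ C Ds (subst (0 <_) (sym d) (s≤s z≤n)))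
    ...   | x , refl = trans (sym c) (trans (h x) d)

  same-profile⇒↭ : ∀ x y → (∀ b → profile x b ≡ profile y b) → proj₁ x ↭ proj₁ y
  same-profile⇒↭ x y h = same-shape-counts⇒↭ (CDC⇒Shapes _ (proj₂ x)) (CDC⇒Shapes _ (proj₂ y))
    (λ z → trans (Balanced⇒mult (balanced x) z) (trans (mult-cong h z) (sym (Balanced⇒mult (balanced y) z))))

  -- Up to order a double cover is determined by its profile, and the profiles are the descending
  -- sequences of length `L` starting from 2, which `code` enumerates.
  numCDC : NumCDC G faces ((ℓ * suc ℓ) / 2)
  numCDC = subst (NumCDC G faces) (#desc-2 L)
    ( (λ x → code 2 (profile x))
    , (λ c → let a , desc , eq = code-surjective 2 c in
         (canonical a desc , canonical-IsCDC a desc) , trans (code-cong 2 (profile-canonical a desc)) eq)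
    , λ x y → mk⇔
        (λ eq → same-profile⇒↭ x y (code-injective 2 (ups-Descending (balanced x)) (ups-Descending (balanced y)) eq))
        (λ p → code-cong 2 (λ b → sumL-↭ (λ C → ⟦ C ≟ˢ sides (U b zero) ⟧) p)))

  -- The multiplicities of `U b zero` and `D b zero` are at most 1 and add up to 2.
  true-profile : ∀ x → Unique (proj₁ x) → ∀ b → profile x b ≡ 1
  true-profile x u b = ≤-antisym (Unique⇒count≤1 u _)
    (+-cancelʳ-≤ 1 1 _ (subst (_≤ profile x b + 1) (at-t (balanced x) b zero)
      (+-monoʳ-≤ (profile x b) (Unique⇒count≤1 u _))))

  -- The profile of the facial double cover: all triangles once, and of the rings only the bottom
  -- and the top one.
  ones : Fin L → ℕ
  ones _ = 1

  ones-after≤1 : ∀ {n} (i : Fin (suc n)) → after {n} (λ _ → 1) i ≤ 1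
  ones-after≤1 {zero}  zero    = z≤n
  ones-after≤1 {suc n} zero    = ≤-refl
  ones-after≤1 {suc n} (suc i) = ones-after≤1 {n} i

  ones-Descending : Descending 2 ones
  ones-Descending zero    = s≤s z≤n
  ones-Descending (suc i) = ones-after≤1 {L} (suc i)

  ones-mult≤1 : ∀ x → mult ones x ≤ 1
  ones-mult≤1 (R zero)    = ≤-refl
  ones-mult≤1 (R (suc i)) = m∸n≤m 1 (after ones (suc i))
  ones-mult≤1 (U b j)     = ≤-refl
  ones-mult≤1 (D b j)     = ≤-refl

  facial-Unique : Unique (canonical ones ones-Descending)
  facial-Unique = count≤1⇒Unique Cs bound
    where
    Cs = canonical ones ones-Descending
    bound : ∀ C → count C Cs ≤ 1
    bound C with count C Cs in c
    ... | zero  = z≤n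
    ... | suc _ with All.lookup (canonical-Shapes ones ones-Descending) (0<count⇒∈ C Cs (subst (0 <_) (sym c) (s≤s z≤n)))
    ...   | x , refl = subst (_≤ 1) (trans (sym (canonical-count ones ones-Descending x)) c) (ones-mult≤1 x)

  numTrueCDC : NumTrueCDC G faces 1
  numTrueCDC = (λ _ → zero)
    , (λ { zero → (canonical ones ones-Descending , canonical-IsCDC ones ones-Descending , facial-Unique) , refl })
    , λ { (Cs , cdc , u) (Ds , cdc′ , u′) → mk⇔
        (λ _ → same-profile⇒↭ (Cs , cdc) (Ds , cdc′)
           (λ b → trans (true-profile (Cs , cdc) u b) (sym (true-profile (Ds , cdc′) u′ b))))
        (λ _ → refl) }

  -- The embedding

  DartE : Set
  DartE = Edge × Bool

  encD : DartE → Dart G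
  encD (x , c) = enc x , c

  decD : Dart G → DartE
  decD (e , c) = dec e , c

  encD-decD : ∀ d → encD (decD d) ≡ d
  encD-decD (e , c) = cong (_, c) (enc-dec e)

  decD-encD : ∀ d → decD (encD d) ≡ d
  decD-encD (x , c) = cong (_, c) (dec-enc x)

  vertE : DartE → V
  vertE (x , false) = tailE x
  vertE (x , true)  = headE x

  vert-decD : ∀ d → vert G d ≡ encV (vertE (decD d))
  vert-decD (e , false) = refl
  vert-decD (e , true)  = refl

  αE : DartE → DartE
  αE (x , c) = x , not c

  -- Counterclockwise around (i , j): east, north-east, north-west, west, south-west, south-east.
  σE : DartE → DartE
  σE (ring i j , false) with view i
  ... | ‵fromℕ     = ring i (prev j) , true
  ... | ‵inject₁ b = s b j , false
  σE (s b j , false)          = t b (prev j) , false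
  σE (t b j , false)          = ring (inject₁ b) j , true
  σE (ring zero j , true)     = ring zero (next j) , false
  σE (ring (suc b) j , true)  = s b (next j) , true
  σE (s b j , true)           = t b j , true
  σE (t b j , true)           = ring (suc b) j , false

  σE-top : ∀ j → σE (ring (fromℕ L) j , false) ≡ (ring (fromℕ L) (prev j) , true)
  σE-top j rewrite view-fromℕ L′ = refl

  σE-inject₁ : ∀ b j → σE (ring (inject₁ b) j , false) ≡ (s b j , false)
  σE-inject₁ b j rewrite view-inject₁ b = refl

  σE-vert : ∀ d → vertE (σE d) ≡ vertE d
  σE-vert (ring i j , false) with view i
  ... | ‵fromℕ     = cong (i ,_) (next-prev j)
  ... | ‵inject₁ b = refl
  σE-vert (s b j , false)          = cong (inject₁ b ,_) (next-prev j)
  σE-vert (t b j , false)          = refl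
  σE-vert (ring zero j , true)     = refl
  σE-vert (ring (suc b) j , true)  = refl
  σE-vert (s b j , true)           = refl
  σE-vert (t b j , true)           = refl

  _↻_ : DartE → DartE → Set
  _↻_ = SameOrbit σE

  east : V → DartE
  east (i , j) = ring i j , false

  -- The upper half of the turn around a vertex, from east to west; `south` is the lower half. On
  -- the top ring, respectively the bottom ring, no dart lies in between.
  north : ∀ i j → east (i , j) ↻ (ring i (prev j) , true)
  north i j with view i
  ... | ‵fromℕ     = once (σE-top j)
  ... | ‵inject₁ b = once (σE-inject₁ b j) ▸ once refl ▸ once refl

  south : ∀ i j → (ring i j , true) ↻ east (i , next j)
  south zero    j = once refl
  south (suc b) j = once refl ▸ once refl ▸ once refl

  -- Together with `from-east` this makes the east dart a base point through which any two darts at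
  -- a vertex are linked.
  to-east : ∀ d → d ↻ east (vertE d)
  to-east (ring i j , false) = stay refl
  to-east (s b j , false)    = once refl ▸ once refl ▸ south (inject₁ b) (prev j) ▸
                               stay (cong (λ q → east (inject₁ b , q)) (next-prev j))
  to-east (t b j , false)    = once refl ▸ south (inject₁ b) j
  to-east (ring i j , true)  = south i j
  to-east (s b j , true)     = once refl ▸ once refl
  to-east (t b j , true)     = once refl

  from-east : ∀ d → east (vertE d) ↻ d
  from-east (ring i j , false) = stay refl
  from-east (s b j , false)    = once (σE-inject₁ b j)
  from-east (t b j , false)    = once (σE-inject₁ b (next j)) ▸ once refl ▸ stay (cong (λ q → t b q , false) (prev-next j))
  from-east (ring i j , true)  = north i (next j) ▸ stay (cong (λ q → ring i q , true) (prev-next j))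
  from-east (s b j , true)     = north (suc b) j ▸ once refl ▸ stay (cong (λ q → s b q , true) (next-prev j))
  from-east (t b j , true)     = from-east (s b j , true) ▸ once refl

  rotation : Rotation G
  rotation = record { σ = σ ; σ-vert = σ-vert ; σ-cyc = σ-cyc }
    where
    σ : Dart G → Dart G
    σ = encD ∘ σE ∘ decD
    σ-vert : ∀ d → vert G (σ d) ≡ vert G d
    σ-vert d = trans (vert-decD (σ d)) (trans (cong (encV ∘ vertE) (decD-encD (σE (decD d))))
      (trans (cong encV (σE-vert (decD d))) (sym (vert-decD d))))
    σ-cyc : ∀ x y → vert G x ≡ vert G y → SameOrbit σ x y
    σ-cyc x y eq = subst₂ (SameOrbit σ) (encD-decD x) (encD-decD y)
      (SameOrbit-map encD (λ d → cong (encD ∘ σE) (sym (decD-encD d)))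
        (to-east (decD x) ▸ stay (cong east same) ▸ from-east (decD y)))
      where
      same : vertE (decD x) ≡ vertE (decD y)
      same = encV-injective (trans (sym (vert-decD x)) (trans eq (vert-decD y)))

  φE : DartE → DartE
  φE = σE ∘ αE

  Face : Set
  Face = Cell (Fin 2)

  pattern bottom = inj₁ zero
  pattern top    = inj₁ (suc zero)

  -- The face on the right of a dart, since `φE` reverses the dart and then turns counterclockwise.
  face : DartE → Face
  face (ring i j , true) with view i
  ... | ‵fromℕ     = top
  ... | ‵inject₁ b = U b j
  face (ring zero j , false)    = bottom
  face (ring (suc b) j , false) = D b j
  face (s b j , false)          = U b j
  face (t b j , false)          = D b j
  face (s b j , true)           = D b (prev j)
  face (t b j , true)           = U b j

  start : Face → DartE
  start bottom  = ring zero zero , false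
  start top     = ring (fromℕ L) zero , true
  start (U b j) = ring (inject₁ b) j , true
  start (D b j) = ring (suc b) j , false

  face-top : ∀ j → face (ring (fromℕ L) j , true) ≡ top
  face-top j rewrite view-fromℕ L′ = refl

  face-inject₁ : ∀ b j → face (ring (inject₁ b) j , true) ≡ U b j
  face-inject₁ b j rewrite view-inject₁ b = refl

  face-start : ∀ F → face (start F) ≡ F
  face-start bottom  = refl
  face-start top     = face-top zero
  face-start (U b j) = face-inject₁ b j
  face-start (D b j) = refl

  face-φE : ∀ d → face (φE d) ≡ face d
  face-φE (ring zero j , false)    = refl
  face-φE (ring (suc b) j , false) = cong (λ q → D b q) (prev-next j)
  face-φE (s b j , false)          = refl
  face-φE (t b j , false)          = refl
  face-φE (ring i j , true) with view i
  ... | ‵fromℕ     = face-top (prev j)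
  ... | ‵inject₁ b = refl
  face-φE (s b j , true)           = refl
  face-φE (t b j , true)           = face-inject₁ b j

  _⟳_ : DartE → DartE → Set
  _⟳_ = SameOrbit φE

  -- Along the two outer faces `φE` runs through a whole ring, by `next` at the bottom and by `prev`
  -- at the top.
  round-bottom : ∀ i j → (ring zero i , false) ⟳ (ring zero j , false)
  round-bottom i j = SameOrbit-map (λ q → ring zero q , false) (λ _ → refl) (next-transitive i j)

  round-top : ∀ i j → (ring (fromℕ L) i , true) ⟳ (ring (fromℕ L) j , true)
  round-top i j = SameOrbit-map (λ q → ring (fromℕ L) q , true) (λ q → sym (σE-top q)) (prev-transitive i j)

  to-start : ∀ d → d ⟳ start (face d)
  to-start (ring zero j , false)    = round-bottom j zero
  to-start (ring (suc b) j , false) = stay refl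
  to-start (s b j , false)          = once refl ▸ once refl
  to-start (t b j , false)          = once refl
  to-start (ring i j , true) with view i
  ... | ‵fromℕ     = round-top j zero
  ... | ‵inject₁ b = stay refl
  to-start (s b j , true)           = once refl ▸ once refl
  to-start (t b j , true)           = once refl

  from-start : ∀ d → start (face d) ⟳ d
  from-start (ring zero j , false)    = round-bottom zero j
  from-start (ring (suc b) j , false) = stay refl
  from-start (s b j , false)          = once (σE-inject₁ b j)
  from-start (t b j , false)          = once refl ▸ once refl ▸ stay (cong (λ q → t b q , false) (prev-next j))
  from-start (ring i j , true) with view i
  ... | ‵fromℕ     = round-top zero j
  ... | ‵inject₁ b = stay refl
  from-start (s b j , true)           = once refl ▸ stay (cong (λ q → s b q , true) (next-prev j))
  from-start (t b j , true)           = once (σE-inject₁ b j) ▸ once refl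

  hasFaces : HasFaces G rotation (cells 2)
  hasFaces = NumClasses-via (cell ↔-refl) (face ∘ decD) (encD ∘ start)
    (λ F → trans (cong face (decD-encD (start F))) (face-start F)) sound complete
    where
    φ : Dart G → Dart G
    φ d = Rotation.σ rotation (α G d)
    sound : ∀ {x y} → SameOrbit φ x y → face (decD x) ≡ face (decD y)
    sound {x} (i , refl) = sym (invariant i)
      where
      invariant : ∀ i → face (decD (iterate φ i x)) ≡ face (decD x)
      invariant zero    = refl
      invariant (suc i) = trans (cong face (decD-encD (φE (decD (iterate φ i x)))))
        (trans (face-φE (decD (iterate φ i x))) (invariant i))
    complete : ∀ x y → face (decD x) ≡ face (decD y) → SameOrbit φ x y
    complete x y eq = subst₂ (SameOrbit φ) (encD-decD x) (encD-decD y)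
      (SameOrbit-map encD (λ d → cong (encD ∘ φE) (sym (decD-encD d)))
        (to-start (decD x) ▸ stay (cong start eq) ▸ from-start (decD y)))

  face-count : cells 2 ≡ 2 * k * L + 2
  face-count = trans (cells≡ 2) (arith L k)
    where
    arith : ∀ l q → 2 + (l * q + l * q) ≡ 2 * q * l + 2
    arith = solve-∀

  euler : n G + (2 * k * L + 2) ≡ m G + 2
  euler = trans (arith #V L k) (cong (_+ 2) (sym (cells≡ #V)))
    where
    arith : ∀ v l q → v + (2 * q * l + 2) ≡ v + (l * q + l * q) + 2
    arith = solve-∀

  -- Connectivity

  -- One adjacent ring is selected for every ring, as a single way out of a damaged ring is enough.
  neighbour : Fin ℓ → Fin ℓ
  neighbour zero    = suc zero
  neighbour (suc b) = inject₁ b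

  neighbour-irrefl : ∀ i → neighbour i ≢ i
  neighbour-irrefl zero    ()
  neighbour-irrefl (suc b) = inject₁≢suc b

  module _ (X : Subset (n G)) where

    Removed Free : V → Set
    Removed v = encV v ∈ X
    Free v    = encV v ∉ X

    removed? : ∀ v → Dec (Removed v)
    removed? v = encV v ∈? X

    _↝_ : V → V → Set
    u ↝ v = Reach G (λ _ → ⊤) (λ w → w ∉ X) (encV u) (encV v)

    forth : ∀ x → Free (headE x) → tailE x ↝ headE x
    forth x free = step (enc x) tt free (adjacent x) here

    back : ∀ x → Free (tailE x) → headE x ↝ tailE x
    back x free = step (enc x) tt free (Adj-sym G (adjacent x)) here

    infixr 5 _▹_
    _▹_ : ∀ {u v w} → u ↝ v → v ↝ w → u ↝ w
    _▹_ = Reach-trans G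

    ascend : ∀ i x → Free (i , suc x) → (i , inject₁ x) ↝ (i , suc x)
    ascend i x free = subst (λ q → (i , inject₁ x) ↝ (i , q)) (next-inject₁ x)
      (forth (ring i (inject₁ x)) (subst (λ q → Free (i , q)) (sym (next-inject₁ x)) free))

    descend : ∀ i x → Free (i , inject₁ x) → (i , suc x) ↝ (i , inject₁ x)
    descend i x free = subst (λ q → (i , q) ↝ (i , inject₁ x)) (next-inject₁ x) (back (ring i (inject₁ x)) free)

    wrap : ∀ i → Free (i , zero) → (i , fromℕ (2 + k′)) ↝ (i , zero)
    wrap i free = subst (λ q → (i , fromℕ (2 + k′)) ↝ (i , q)) (next-fromℕ (2 + k′))
      (forth (ring i (fromℕ (2 + k′))) (subst (λ q → Free (i , q)) (sym (next-fromℕ (2 + k′))) free))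

    Thick : Fin ℓ → Set
    Thick i = ∃₂ λ p q → p ≢ q × Removed (i , p) × Removed (i , q)

    thick? : ∀ i → Dec (Thick i)
    thick? i = any? (λ p → any? (λ q → ¬? (p ≟ q) ×-dec (removed? (i , p) ×-dec removed? (i , q))))

    -- A polygon that lost at most one vertex is whole or a path, so its remaining vertices can all
    -- be led to a common one.
    anchor : ∀ i → ¬ Thick i → ∃ λ z → ∀ j → Free (i , j) → (i , j) ↝ z
    anchor i thin with any? (λ p → removed? (i , p))
    ... | no none = (i , zero) , λ j _ → <-weakInduction (λ j → (i , j) ↝ (i , zero)) here
                      (λ x r → descend i x (λ rem → none (inject₁ x , rem)) ▹ r) j
    ... | yes (p , p∈) = go p refl
      where
      free : ∀ {j} → j ≢ p → Free (i , j)
      free ne j∈ = thin (_ , _ , ne , j∈ , p∈)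
      to-top : ∀ j → toℕ p < toℕ j → (i , j) ↝ (i , fromℕ (2 + k′))
      to-top = >-weakInduction _ (λ _ → here) (λ x r lt →
        let lt′ = ≤-trans (subst (toℕ p <_) (toℕ-inject₁ x) lt) (n≤1+n _)
        in ascend i x (free (<⇒≢ lt′ ∘ sym ∘ cong toℕ)) ▹ r lt′)
      to-zero : ∀ j → toℕ j < toℕ p → (i , j) ↝ (i , zero)
      to-zero = <-weakInduction _ (λ _ → here) (λ x r lt →
        let lt′ = subst (_< toℕ p) (sym (toℕ-inject₁ x)) (≤-trans (n≤1+n _) lt)
        in descend i x (free (<⇒≢ lt′ ∘ cong toℕ)) ▹ r lt′)
      -- If column zero is the missing one, everything climbs to the last column. Otherwise the
      -- vertices before `p` descend to zero, and those after `p` climb to the last column and wrap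
      -- around.
      go : ∀ p′ → p′ ≡ p → ∃ λ z → ∀ j → Free (i , j) → (i , j) ↝ z
      go zero refl = (i , fromℕ (2 + k′)) , λ where
        zero    j∉ → contradiction p∈ j∉
        (suc j) j∉ → to-top (suc j) (s≤s z≤n)
      go (suc p′) refl = (i , zero) , λ j j∉ → by-cases j j∉ (<-cmp (toℕ j) (toℕ p))
        where
        by-cases : ∀ j → Free (i , j) → Tri (toℕ j < toℕ p) (toℕ j ≡ toℕ p) (toℕ p < toℕ j) → (i , j) ↝ (i , zero)
        by-cases j j∉ (tri< lt _ _) = to-zero j lt
        by-cases j j∉ (tri≈ _ eq _) = contradiction p∈ (subst (λ q → Free (i , q)) (toℕ-injective eq) j∉)
        by-cases j j∉ (tri> _ _ gt) = to-top j gt ▹ wrap i (free (λ ()))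

    four : ∀ {i i′ p q p′ q′} → i ≢ i′ → p ≢ q → p′ ≢ q′ →
      Removed (i , p) → Removed (i , q) → Removed (i′ , p′) → Removed (i′ , q′) → 4 ≤ ∣ X ∣
    four {i} {i′} {p} {q} {p′} {q′} i≢ p≢ p≢′ a b c d = injection⇒≤∣∣ X (encV ∘ g) (g-inj ∘ encV-injective)
      (λ { zero → a ; (suc zero) → b ; (suc (suc zero)) → c ; (suc (suc (suc zero))) → d })
      where
      g : Fin 4 → V
      g = extend (i , p) (three (i , q) (i′ , p′) (i′ , q′))
      g-inj : Inj g
      g-inj = extend-injective
        (λ { zero eq → p≢ (sym (cong proj₂ eq)) ; (suc zero) eq → i≢ (sym (cong proj₁ eq))
           ; (suc (suc zero)) eq → i≢ (sym (cong proj₁ eq)) })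
        (three-injective (i≢ ∘ cong proj₁) (i≢ ∘ cong proj₁) (p≢′ ∘ cong proj₂))

    hops : ∀ i j → ∃₂ λ p q → p ≢ q × (Free (neighbour i , p) → (i , j) ↝ (neighbour i , p)) ×
                                       (Free (neighbour i , q) → (i , j) ↝ (neighbour i , q))
    hops zero j = j , prev j , (prev-irrefl j ∘ sym) , forth (s zero j) ,
      (λ free → subst (λ q → (zero , q) ↝ (suc zero , prev j)) (next-prev j) (forth (t zero (prev j)) free))
    hops (suc b) j = j , next j , (next-irrefl j ∘ sym) , back (s b j) , back (t b j)

    module _ (small : ∣ X ∣ < 4) where

      -- If both neighbours of `(i , j)` in the adjacent ring were removed too, four vertices would
      -- be missing in all.
      escape : ∀ i j → Thick i → ∃ λ j′ → Free (neighbour i , j′) × (i , j) ↝ (neighbour i , j′)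
      escape i j (p , q , p≢q , p∈ , q∈) with hops i j
      ... | p′ , q′ , ne , hop , hop′ with removed? (neighbour i , p′) | removed? (neighbour i , q′)
      ...   | no free | _       = p′ , free , hop free
      ...   | yes _   | no free = q′ , free , hop′ free
      ...   | yes a   | yes b   = contradiction (four (neighbour-irrefl i ∘ sym) p≢q ne p∈ q∈ a b) (<⇒≱ small)

      neighbour-thin : ∀ i → Thick i → ¬ Thick (neighbour i)
      neighbour-thin i (_ , _ , ne , a , b) (_ , _ , ne′ , c , d) =
        <⇒≱ small (four (neighbour-irrefl i ∘ sym) ne ne′ a b c d)

      hub⇒connected : ∀ z → (∀ v → Free v → v ↝ z) → ∀ u v → Free u → Free v → u ↝ v
      hub⇒connected z to-z u v fu fv = to-z u fu ▹ Reach-sym G fv (to-z v fv)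

      -- The intact column is a path through all rings, and a ring that is not thick is tied to it.
      -- From a thick ring one first escapes to its neighbour, which is not thick.
      column⇒connected : ∀ c → (∀ i → Free (i , c)) → ∀ u v → Free u → Free v → u ↝ v
      column⇒connected c free = hub⇒connected (zero , c) to-hub
        where
        down : ∀ i → (i , c) ↝ (zero , c)
        down = <-weakInduction _ here (λ b r → back (s b c) (free (inject₁ b)) ▹ r)
        thin-to-hub : ∀ i j → ¬ Thick i → Free (i , j) → (i , j) ↝ (zero , c)
        thin-to-hub i j thin f with anchor i thin
        ... | z , to-z = to-z j f ▹ Reach-sym G (free i) (to-z c (free i)) ▹ down i
        to-hub : ∀ v → Free v → v ↝ (zero , c)
        to-hub (i , j) f with thick? i
        ... | no thin = thin-to-hub i j thin f
        ... | yes thick with escape i j thick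
        ...   | j′ , f′ , r = r ▹ thin-to-hub (neighbour i) j′ (neighbour-thin i thick) f′

      -- Of the only two rings the other one is not thick, so it is connected, and every vertex of
      -- the thick ring escapes to it.
      thick⇒connected : ∀ i → Thick i → (∀ i′ → i′ ≡ i ⊎ i′ ≡ neighbour i) → ∀ u v → Free u → Free v → u ↝ v
      thick⇒connected i thick two-rows with anchor (neighbour i) (neighbour-thin i thick)
      ... | z , to-z = hub⇒connected z to-hub
        where
        to-hub : ∀ v → Free v → v ↝ z
        to-hub (i′ , j) f with two-rows i′
        ... | inj₂ refl = to-z j f
        ... | inj₁ refl with escape i j thick
        ...   | j′ , f′ , r = r ▹ to-z j′ f′

      -- If every column is hit, then at least k vertices are removed, and with fewer than k rings two of
      -- them lie in the same ring.  The second alternative is needed only for the octahedron.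
      remains-connected : ∣ X ∣ < k ⊎ (ℓ < k × ∀ i i′ → i′ ≡ i ⊎ i′ ≡ neighbour i) → ∀ u v → Free u → Free v → u ↝ v
      remains-connected h with any? (λ c → all? (λ i → ¬? (removed? (i , c))))
      ... | yes (c , free) = column⇒connected c free
      ... | no none = hit h
        where
        hits : ∀ c → ∃ λ i → Removed (i , c)
        hits c with ¬∀⟶∃¬ ℓ _ (λ i → ¬? (removed? (i , c))) (λ free → none (c , free))
        ... | i , r = i , decidable-stable (removed? (i , c)) r
        hit : ∣ X ∣ < k ⊎ (ℓ < k × ∀ i i′ → i′ ≡ i ⊎ i′ ≡ neighbour i) → ∀ u v → Free u → Free v → u ↝ v
        hit (inj₁ lt) = contradiction (injection⇒≤∣∣ X (λ c → encV (proj₁ (hits c) , c))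
          (λ eq → cong proj₂ (encV-injective eq)) (λ c → proj₂ (hits c))) (<⇒≱ lt)
        hit (inj₂ (ℓ<k , two-rows)) with pigeonhole ℓ<k (λ c → proj₁ (hits c))
        ... | p , q , p<q , eq = thick⇒connected (proj₁ (hits p))
          (p , q , (<⇒≢ p<q ∘ cong toℕ) , proj₂ (hits p) , subst (λ i → Removed (i , q)) (sym eq) (proj₂ (hits q)))
          (two-rows (proj₁ (hits p)))

  kConnected : ∀ r → r ≤ 4 → r ≤ k ⊎ (ℓ < k × ∀ i i′ → i′ ≡ i ⊎ i′ ≡ neighbour i) → KConnected G r
  kConnected r r≤4 h =
    -- There are at least `2 * 3` vertices, and `r` is at most 4.
    subst (r <_) (sym #V≡) (≤-trans (s≤s r≤4) (≤-trans (n≤1+n 5)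
      (*-mono-≤ {2} {ℓ} {3} {k} (s≤s (s≤s z≤n)) (s≤s (s≤s (s≤s z≤n)))))) ,
    λ X small u v u∉ v∉ → subst₂ (Reach G _ _) (encV-decV u) (encV-decV v)
      (remains-connected X (≤-trans small r≤4) (map₁ (≤-trans small) h) (decV u) (decV v)
        (u∉ ∘ subst (_∈ X) (encV-decV u)) (v∉ ∘ subst (_∈ X) (encV-decV v)))

  connected : Connected G
  connected u v = Reach-weaken G (λ _ _ → tt)
    (proj₂ (kConnected 3 (n≤1+n 3) (inj₁ (s≤s (s≤s (s≤s z≤n))))) ⊥ (subst (_< 3) (sym (∣⊥∣≡0 (n G))) (s≤s z≤n)) u v ∉⊥ ∉⊥)

  plane : ConnectedPlaneWithFaces G faces
  plane = connected , rotation , subst (HasFaces G rotation) face-count hasFaces , euler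

-- The octahedron and the conclusion.

octahedron-rows : ∀ i i′ → i′ ≡ i ⊎ i′ ≡ Stack.neighbour 0 0 i
octahedron-rows zero       zero       = inj₁ refl
octahedron-rows zero       (suc zero) = inj₂ refl
octahedron-rows (suc zero) zero       = inj₂ refl
octahedron-rows (suc zero) (suc zero) = inj₁ refl

theorem2 : ∀ (k ℓ : ℕ) → 3 ≤ k → 2 ≤ ℓ →
    Σ Graph (λ G →
    ConnectedPlaneWithFaces G (2 * k * (ℓ ∸ 1) + 2) ×
    NumCDC G (2 * k * (ℓ ∸ 1) + 2) ((ℓ * suc ℓ) / 2) ×
    NumTrueCDC G (2 * k * (ℓ ∸ 1) + 2) 1 ×
    ((k ≡ 3 × 3 ≤ ℓ → KConnected G 3) × (¬ (k ≡ 3 × 3 ≤ ℓ) → KConnected G 4)))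
theorem2 (suc (suc (suc k′))) (suc (suc L′)) (s≤s (s≤s (s≤s z≤n))) (s≤s (s≤s z≤n)) =
  G , plane , numCDC , numTrueCDC , (λ _ → kConnected 3 (n≤1+n 3) (inj₁ (s≤s (s≤s (s≤s z≤n))))) , 4-connected k′ L′
  where
  open Stack L′ k′
  4-connected : ∀ k′ L′ → ¬ (3 + k′ ≡ 3 × 3 ≤ 2 + L′) → KConnected (Stack.G L′ k′) 4
  -- With at least four columns, three removed vertices cannot hit all of them.
  4-connected (suc k′) L′       h = Stack.kConnected L′ (suc k′) 4 ≤-refl (inj₁ (s≤s (s≤s (s≤s (s≤s z≤n)))))
  -- This is the octahedron, which has two rings and three columns: if all columns are hit, some
  -- ring loses two vertices.
  4-connected zero     zero     h = Stack.kConnected 0 0 4 ≤-refl (inj₂ (≤-refl , octahedron-rows))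
  4-connected zero     (suc L′) h = contradiction (refl , s≤s (s≤s (s≤s z≤n))) h
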